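{- Let $G$ be a (finite) tree and $\gamma\in(0,1)$. Then for every initial state $s_0\in S$ there exists a Nash equilibrium $\widehat{\sigma}$ of $\Gamma_3(G|s_0)$ (in deterministic strategies) such that $\mathbf{K}_3(G|s_0,\widehat{\sigma})>0$.
   Context: Game $\Gamma_3(G|s_0)$ on $G=(V,E)$. $N[x]$ is the closed neighborhood of $x$ in $G$. Nonterminal states: $S=\{(x^1,x^2,x^3,p): x^i\in V,\ p\in\{1,2,3\}\}$, where $x^i$ is the vertex of player $P_i$ and $p$ is the index of the player who moves next. There is one additional terminal state $\overline{s}$. Capture sets: $\widetilde{S}^1=\{s\in S: x^1=x^2\}$ ($P_1$ captures $P_2$), $\widetilde{S}^2=\{s\in S: x^2=x^3\}$ ($P_2$ captures $P_3$); $S_C=\widetilde{S}^1\cup\widetilde{S}^2$, $S_{NC}=S\setminus S_C$. Action sets: for $s=(x^1,x^2,x^3,p)\in S_{NC}$, $A^p(s)=N[x^p]$ and $A^m(s)=\{x^m\}$ for $m\neq p$; for $s\in S_C\cup\{\overline{s}\}$, $A^m(s)=\{\lambda\}$ (null move). Transitions: for $s=(x^1,x^2,x^3,n)\in S_{NC}$ and $a\in A^n(s)$, $\mathbf{T}(s,a)$ is obtained by replacing $x^n$ by $a$ and letting the next mover be $n+1$ (or $1$ if $n=3$). For $s\in S_C\cup\{\overline{s}\}$, $\mathbf{T}(s,\lambda)=\overline{s}$. Strategies: a deterministic strategy $\sigma^n$ assigns to each finite history $s_0s_1\dots s_t$ ($t\ge0$) an action in $A^n(s_t)$. A profile $\sigma$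 and a starting state $s_0$ determine a play $s_0s_1s_2\dots$ with $s_{t+1}=\mathbf{T}(s_t,a)$, $a$ being the action chosen by the player who has the move (and $a=\lambda$ when $s_t\in S_C\cup\{\overline{s}\}$). $\sigma^{ -n}$ denotes the strategies of the players other than $P_n$. Turn payoffs: $q^1(s)=1$ if $s\in\widetilde{S}^1$, else $0$; $q^2(s)=-1$ if $s\in\widetilde{S}^1$, $1$ if $s\in\widetilde{S}^2\setminus\widetilde{S}^1$, else $0$; $q^3(s)=-1$ if $s\in\widetilde{S}^2\setminus\widetilde{S}^1$, else $0$. Total payoffs: $Q^n(s_0,\sigma)=\sum_{t=0}^\infty\gamma^tq^n(s_t)$. A Nash equilibrium of $\Gamma_3(G|s_0)$ is a profile $\widehat\sigma$ with $Q^n(s_0,\widehat\sigma)\ge Q^n(s_0,\sigma^n,\widehat\sigma^{ -n})$ for all $n\in\{1,2,3\}$ and all $\sigma^n$. Capture function: $\mathbf{K}_3(G|s_0,\sigma)=0$ when $Q^1(s_0,\sigma)=Q^2(s_0,\sigma)=Q^3(s_0,\sigma)=0$; $=1$ when $Q^1(s_0,\sigma)>0$; $=2$ when $Q^2(s_0,\sigma)>0$. -}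

module Defs where

open import Algebra.Apartness.Structures using (IsHeytingField)
open import Algebra.Bundles using (CommutativeRing; CommutativeSemiring; Semiring)
open import Algebra.Core using (Op₁; Op₂)
import Algebra.Definitions.RawSemiring as RawSemiringDefs
import Algebra.Solver.Ring.NaturalCoefficients.Default as Solver
open import Data.Bool.Base using (true; false; if_then_else_)
open import Data.Empty using (⊥-elim)
open import Data.Fin.Base using (Fin; zero; suc; inject₁; fromℕ)
open import Data.Fin.Properties using (_≟_)
open import Data.List.NonEmpty using (List⁺; head; [_]; _∷⁺_)
open import Data.Nat.Base as ℕ using (ℕ; zero; suc)
open import Data.Nat.Properties using (≤⇒≤′)
open import Data.Product.Base using (∃-syntax; _×_; _,_; proj₁; proj₂)
open import Data.Sum.Base using (_⊎_; inj₁; inj₂)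
open import Data.Vec.Base using (Vec; lookup; _[_]≔_)
open import Function.Definitions using (Injective)
open import Level using (0ℓ; _⊔_) renaming (suc to lsuc)
open import Relation.Binary.Construct.Closure.ReflexiveTransitive using (Star)
open import Relation.Binary.Core using (Rel)
open import Relation.Binary.Definitions using (Decidable; Symmetric)
open import Relation.Binary.PropositionalEquality.Core as ≡ using (_≡_; _≢_)
open import Relation.Binary.Structures using (IsStrictPartialOrder)
open import Relation.Nullary using (¬_; Dec; does; yes; no)
open import Relation.Nullary.Decidable using (_⊎-dec_)
open import Relation.Unary using (Pred)

------------------------------------------------------------------------
-- Real numbers

-- The real numbers are axiomatised (RealField) as an Archimedean ordered field in which
-- Cauchy sequences converge.  Classically ℝ is the only model, up to
-- isomorphism.  The order is not assumed decidable, so that constructive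
-- (e.g. Bishop) reals are a model too; accordingly x ≤ y means ¬ (y < x).

record OrderedField c ℓ₁ ℓ₂ : Set (lsuc (c ⊔ ℓ₁ ⊔ ℓ₂)) where
  infix  8 -_
  infixl 7 _*_
  infixl 6 _+_
  infix  4 _≈_ _<_ _#_ _≤_ _≥_ _>_
  field
    Carrier : Set c
    _≈_     : Rel Carrier ℓ₁
    _<_     : Rel Carrier ℓ₂
    _+_ _*_ : Op₂ Carrier
    -_      : Op₁ Carrier
    0# 1#   : Carrier

  _#_ : Rel Carrier ℓ₂
  x # y = x < y ⊎ y < x

  field
    isHeytingField       : IsHeytingField _≈_ _#_ _+_ _*_ -_ 0# 1#
    isStrictPartialOrder : IsStrictPartialOrder _≈_ _<_
    +-monoˡ-<            : ∀ z {x y} → x < y → x + z < y + z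
    *-pos                : ∀ {x y} → 0# < x → 0# < y → 0# < x * y

  _≤_ _≥_ _>_ : Rel Carrier ℓ₂
  x ≤ y = ¬ (y < x)
  x ≥ y = y ≤ x
  x > y = y < x

  commutativeRing : CommutativeRing c ℓ₁
  commutativeRing = record
    { isCommutativeRing = IsHeytingField.isCommutativeRing isHeytingField }

  open RawSemiringDefs (Semiring.rawSemiring (CommutativeRing.semiring commutativeRing))
    public using (_^_) renaming (_×_ to _·_)

  -- |f m - f n| < ε for all m, n ≥ N (m and n play symmetric roles).
  Cauchy : (ℕ → Carrier) → Set (c ⊔ ℓ₂)
  Cauchy f = ∀ {ε} → 0# < ε →
    ∃[ N ] ∀ {m n} → N ℕ.≤ m → N ℕ.≤ n → f n < f m + ε

  -- |f n - l| < ε for all n ≥ N.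
  infix 4 _⟶_
  _⟶_ : (ℕ → Carrier) → Carrier → Set (c ⊔ ℓ₂)
  f ⟶ l = ∀ {ε} → 0# < ε →
    ∃[ N ] ∀ {n} → N ℕ.≤ n → (f n < l + ε) × (l < f n + ε)

  partialSum : (ℕ → Carrier) → ℕ → Carrier
  partialSum f zero    = 0#
  partialSum f (suc N) = partialSum f N + f N

record RealField c ℓ₁ ℓ₂ : Set (lsuc (c ⊔ ℓ₁ ⊔ ℓ₂)) where
  field
    orderedField : OrderedField c ℓ₁ ℓ₂

  open OrderedField orderedField public

  field
    archimedean : ∀ x → ∃[ n ] x < n · 1#
    complete    : ∀ f → Cauchy f → ∃[ l ] f ⟶ l

  Σ∞ : (f : ℕ → Carrier) → Cauchy (partialSum f) → Carrier
  Σ∞ f cauchy = proj₁ (complete (partialSum f) cauchy)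

module RealProperties {c ℓ₁ ℓ₂} (ℝ : RealField c ℓ₁ ℓ₂) where

  open RealField ℝ
  open CommutativeRing commutativeRing
    hiding (Carrier; _≈_; _+_; _*_; -_; 0#; 1#)
  open IsHeytingField isHeytingField using (#-cotrans; #⇒invertible; invertible⇒#)
  open IsStrictPartialOrder isStrictPartialOrder public
    using (<-respʳ-≈; <-respˡ-≈; asym)
    renaming (irrefl to <-irrefl; trans to <-trans)

  <-resp : ∀ {x x′ y y′} → x ≈ x′ → y ≈ y′ → x < y → x′ < y′
  <-resp p q r = <-respʳ-≈ q (<-respˡ-≈ p r)

  ≤-resp : ∀ {x x′ y y′} → x ≈ x′ → y ≈ y′ → x ≤ y → x′ ≤ y′
  ≤-resp p q r s = r (<-resp (sym q) (sym p) s)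

  <-cotrans : ∀ {x y} → x < y → ∀ z → x < z ⊎ z < y
  <-cotrans x<y z with #-cotrans (inj₁ x<y) z
  ... | inj₁ (inj₁ x<z) = inj₁ x<z
  ... | inj₁ (inj₂ z<x) = inj₂ (<-trans z<x x<y)
  ... | inj₂ (inj₁ z<y) = inj₂ z<y
  ... | inj₂ (inj₂ y<z) = inj₁ (<-trans x<y y<z)

  <⇒≤ : ∀ {x y} → x < y → x ≤ y
  <⇒≤ = asym

  ≤-reflexive : ∀ {x y} → x ≈ y → x ≤ y
  ≤-reflexive x≈y = <-irrefl (sym x≈y)

  ≤-trans : ∀ {x y z} → x ≤ y → y ≤ z → x ≤ z
  ≤-trans {y = y} x≤y y≤z z<x with <-cotrans z<x y
  ... | inj₁ z<y = y≤z z<y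
  ... | inj₂ y<x = x≤y y<x

  <-≤-trans : ∀ {x y z} → x < y → y ≤ z → x < z
  <-≤-trans {z = z} x<y y≤z with <-cotrans x<y z
  ... | inj₁ x<z = x<z
  ... | inj₂ z<y = ⊥-elim (y≤z z<y)

  ≤-<-trans : ∀ {x y z} → x ≤ y → y < z → x < z
  ≤-<-trans {x = x} x≤y y<z with <-cotrans y<z x
  ... | inj₁ y<x = ⊥-elim (x≤y y<x)
  ... | inj₂ x<z = x<z

  +-monoʳ-< : ∀ z {x y} → x < y → z + x < z + y
  +-monoʳ-< z x<y = <-resp (+-comm _ z) (+-comm _ z) (+-monoˡ-< z x<y)

  +-cancelʳ-< : ∀ z {x y} → x + z < y + z → x < y
  +-cancelʳ-< z r = <-resp (cancel _) (cancel _) (+-monoˡ-< (- z) r)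
    where
    cancel : ∀ x → (x + z) + - z ≈ x
    cancel x = trans (+-assoc x z (- z))
                     (trans (+-congˡ (-‿inverseʳ z)) (+-identityʳ x))

  +-cancelˡ-< : ∀ z {x y} → z + x < z + y → x < y
  +-cancelˡ-< z r = +-cancelʳ-< z (<-resp (+-comm z _) (+-comm z _) r)

  +-monoˡ-≤ : ∀ z {x y} → x ≤ y → x + z ≤ y + z
  +-monoˡ-≤ z x≤y r = x≤y (+-cancelʳ-< z r)

  +-monoʳ-≤ : ∀ z {x y} → x ≤ y → z + x ≤ z + y
  +-monoʳ-≤ z x≤y r = x≤y (+-cancelˡ-< z r)

  x<x+y : ∀ x {y} → 0# < y → x < x + y
  x<x+y x 0<y = <-respˡ-≈ (+-identityʳ x) (+-monoʳ-< x 0<y)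

  0<y-x : ∀ {x y} → x < y → 0# < y - x
  0<y-x {x} x<y = <-respˡ-≈ (-‿inverseʳ x) (+-monoˡ-< (- x) x<y)

  *-monoˡ-< : ∀ {z} → 0# < z → ∀ {x y} → x < y → z * x < z * y
  *-monoˡ-< {z} 0<z {x} {y} x<y =
    <-respʳ-≈ eq (x<x+y (z * x) (*-pos 0<z (0<y-x x<y)))
    where
    eq : z * x + z * (y - x) ≈ z * y
    eq = trans (sym (distribˡ z x (y - x)))
         (*-congˡ (trans (+-comm x (y - x))
                  (trans (+-assoc y (- x) x)
                  (trans (+-congˡ (-‿inverseˡ x)) (+-identityʳ y)))))

  x-0≈x : ∀ x → x - 0# ≈ x
  x-0≈x x = trans (sym (+-identityʳ _)) (trans (+-assoc x (- 0#) 0#)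
            (trans (+-congˡ (-‿inverseˡ 0#)) (+-identityʳ x)))

  0<1 : 0# < 1#
  0<1 with invertible⇒# {1#} {0#}
             (1# , trans (*-identityˡ _) (x-0≈x 1#) , trans (*-identityʳ _) (x-0≈x 1#))
  ... | inj₂ 0<1 = 0<1
  ... | inj₁ 1<0 = ⊥-elim (asym 0<-1
          (<-resp (*-identityʳ _) (zeroʳ _) (*-monoˡ-< 0<-1 1<0)))
    where
    0<-1 : 0# < 0# - 1#
    0<-1 = 0<y-x 1<0

  positiveInverse : ∀ {x} → 0# < x → ∃[ y ] (0# < y × y * x ≈ 1#)
  positiveInverse {x} 0<x with #⇒invertible {x} {0#} (inj₂ 0<x)
  ... | y , yx≈1 , _ = y , positive y#0 , yx≈1′
    where
    yx≈1′ : y * x ≈ 1#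
    yx≈1′ = trans (*-congˡ (sym (x-0≈x x))) yx≈1

    y#0 : y # 0#
    y#0 = invertible⇒#
      (x , trans (*-congˡ (x-0≈x y)) (trans (*-comm x y) yx≈1′)
         , trans (*-congʳ (x-0≈x y)) yx≈1′)

    positive : y # 0# → 0# < y
    positive (inj₂ 0<y) = 0<y
    positive (inj₁ y<0) = ⊥-elim (asym 0<1
      (<-resp (trans (*-comm x y) yx≈1′) (zeroʳ x) (*-monoˡ-< 0<x y<0)))

  *-cancelˡ-< : ∀ {z} → 0# < z → ∀ {x y} → z * x < z * y → x < y
  *-cancelˡ-< {z} 0<z {x} {y} zx<zy with positiveInverse 0<z
  ... | w , 0<w , wz≈1 = <-resp (cancel x) (cancel y) (*-monoˡ-< 0<w zx<zy)
    where
    cancel : ∀ x → w * (z * x) ≈ x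
    cancel x = trans (sym (*-assoc w z x)) (trans (*-congʳ wz≈1) (*-identityˡ x))

  *-monoˡ-≤ : ∀ {z} → 0# < z → ∀ {x y} → x ≤ y → z * x ≤ z * y
  *-monoˡ-≤ 0<z x≤y zy<zx = x≤y (*-cancelˡ-< 0<z zy<zx)

  -x<0 : ∀ {x} → 0# < x → - x < 0#
  -x<0 {x} 0<x = <-resp (+-identityˡ (- x)) (-‿inverseʳ x) (+-monoˡ-< (- x) 0<x)

  0-bounded : - 1# ≤ 0# × 0# ≤ 1#
  0-bounded = <⇒≤ (-x<0 0<1) , <⇒≤ 0<1

  1-bounded : - 1# ≤ 1# × 1# ≤ 1#
  1-bounded = <⇒≤ (<-trans (-x<0 0<1) 0<1) , ≤-reflexive refl

  -1-bounded : - 1# ≤ - 1# × - 1# ≤ 1#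
  -1-bounded = ≤-reflexive refl , <⇒≤ (<-trans (-x<0 0<1) 0<1)

  0<suc·1 : ∀ n → 0# < suc n · 1#
  0<suc·1 zero    = <-respʳ-≈ (sym (+-identityʳ 1#)) 0<1
  0<suc·1 (suc n) = <-trans (0<suc·1 n)
    (<-respʳ-≈ (+-comm _ 1#) (x<x+y _ 0<1))

module SemiringIdentities {c ℓ} (R : CommutativeSemiring c ℓ) where

  open CommutativeSemiring R
  open Solver R using (solve; _:=_; _:+_; _:*_)

  identity₁ : ∀ g d j p →
    (d * (j * (g * p)) + g * p) + d * (d * (j * p)) ≈ (g + d) * (d * (j * p)) + g * p
  identity₁ = solve 4 (λ g d j p →
    (d :* (j :* (g :* p)) :+ g :* p) :+ d :* (d :* (j :* p))
    := (g :+ d) :* (d :* (j :* p)) :+ g :* p) refl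

  identity₂ : ∀ g d o k p →
    d * ((o + k) * p) + g * p ≈ d * (k * p) + (g * p + d * (o * p))
  identity₂ = solve 5 (λ g d o k p →
    d :* ((o :+ k) :* p) :+ g :* p := d :* (k :* p) :+ (g :* p :+ d :* (o :* p))) refl

  identity₃ : ∀ p e w → (p * e) * (w + w) ≈ p * (w * e) + p * (w * e)
  identity₃ = solve 3 (λ p e w → (p :* e) :* (w :+ w) := p :* (w :* e) :+ p :* (w :* e)) refl

  identity₄ : ∀ p d e k → (p * (d * e)) * k ≈ e * (d * (k * p))
  identity₄ = solve 4 (λ p d e k → (p :* (d :* e)) :* k := e :* (d :* (k :* p))) refl

  identity₅ : ∀ g d s a p → (d * s + g * p) + d * a ≈ d * (s + a) + g * p
  identity₅ = solve 5 (λ g d s a p → (d :* s :+ g :* p) :+ d :* a := d :* (s :+ a) :+ g :* p) refl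

  identity₆ : ∀ g d s p → (d * s + g * p) + d * p ≈ d * s + (g + d) * p
  identity₆ = solve 4 (λ g d s p →
    (d :* s :+ g :* p) :+ d :* p := d :* s :+ (g :+ d) :* p) refl

  identity₇ : ∀ g d s a p →
    (d * s + g * p) + d * (a + p) ≈ d * (s + a) + (g + d) * p
  identity₇ = solve 5 (λ g d s a p →
    (d :* s :+ g :* p) :+ d :* (a :+ p) := d :* (s :+ a) :+ (g :+ d) :* p) refl

  identity₈ : ∀ a b p s → (s + p) + (a + b) ≈ (a + p) + (s + b)
  identity₈ = solve 4 (λ a b p s → (s :+ p) :+ (a :+ b) := (a :+ p) :+ (s :+ b)) refl

  identity₉ : ∀ a b q r → (r + q) + (a + b) ≈ (r + b) + (a + q)
  identity₉ = solve 4 (λ a b q r → (r :+ q) :+ (a :+ b) := (r :+ b) :+ (a :+ q)) refl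

-- A discounted series with terms in [-1, 1] has Cauchy partial sums.

module Discounting {c ℓ₁ ℓ₂} (ℝ : RealField c ℓ₁ ℓ₂)
                   (γ : RealField.Carrier ℝ)
                   (0<γ : RealField._<_ ℝ (RealField.0# ℝ) γ)
                   (γ<1 : RealField._<_ ℝ γ (RealField.1# ℝ)) where

  open RealField ℝ

  open CommutativeRing commutativeRing
    hiding (Carrier; _≈_; _+_; _*_; -_; 0#; 1#)
  open RealProperties ℝ
  open SemiringIdentities commutativeSemiring

  d : Carrier
  d = 1# - γ

  0<d : 0# < d
  0<d = 0<y-x γ<1

  γ+d≈1 : γ + d ≈ 1#
  γ+d≈1 = trans (+-comm γ d) (trans (+-assoc 1# (- γ) γ)
          (trans (+-congˡ (-‿inverseˡ γ)) (+-identityʳ 1#)))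

  [γ+d]* : ∀ x → (γ + d) * x ≈ x
  [γ+d]* x = trans (*-congʳ γ+d≈1) (*-identityˡ x)

  0<γ^ : ∀ n → 0# < γ ^ n
  0<γ^ zero    = 0<1
  0<γ^ (suc n) = *-pos 0<γ (0<γ^ n)

  bernoulli : ∀ n → d * ((n · 1#) * γ ^ n) + γ ^ n ≤ 1#
  bernoulli zero = ≤-reflexive (trans (+-congʳ (trans (*-congˡ (zeroˡ _)) (zeroʳ d)))
                                      (+-identityˡ 1#))
  bernoulli (suc n) = ≤-trans
    (≤-resp refl eq (<⇒≤ (x<x+y _ (*-pos 0<d (*-pos 0<d (*-pos (0<suc·1 n) (0<γ^ n)))))))
    (bernoulli n)
    where
    k = n · 1#
    p = γ ^ n
    eq : (d * ((1# + k) * (γ * p)) + γ * p) + d * (d * ((1# + k) * p))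
         ≈ d * (k * p) + p
    eq = trans
      (identity₁ γ d (1# + k) p)
      (trans (+-congʳ ([γ+d]* _))
      (trans (identity₂ γ d 1# k p)
      (+-congˡ (trans (+-congˡ (*-congˡ (*-identityˡ p)))
               (trans (sym (distribʳ p γ d)) ([γ+d]* p))))))

  γ^-small : ∀ {δ} → 0# < δ → ∃[ n ] γ ^ n + γ ^ n < δ
  γ^-small {δ} 0<δ with positiveInverse (*-pos 0<d 0<δ)
  ... | w , 0<w , w*dδ≈1 with archimedean (w + w)
  ... | n , w+w<n = n , <-≤-trans
      (<-resp lhs rhs (*-monoˡ-< (*-pos (0<γ^ n) (*-pos 0<d 0<δ)) w+w<n))
      (≤-trans
        (*-monoˡ-≤ 0<δ (≤-trans (<⇒≤ (x<x+y _ (0<γ^ n))) (bernoulli n)))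
        (≤-reflexive (*-identityʳ δ)))
    where
    p = γ ^ n
    lhs : (p * (d * δ)) * (w + w) ≈ p + p
    lhs = trans (identity₃ p (d * δ) w)
                (+-cong pwe≈p pwe≈p)
      where
      pwe≈p : p * (w * (d * δ)) ≈ p
      pwe≈p = trans (*-congˡ w*dδ≈1) (*-identityʳ p)
    rhs : (p * (d * δ)) * (n · 1#) ≈ δ * (d * ((n · 1#) * p))
    rhs = identity₄ p d δ (n · 1#)

  module _ (f : ℕ → Carrier) (f-bounded : ∀ t → - 1# ≤ f t × f t ≤ 1#) where

    discounted : ℕ → Carrier
    discounted t = γ ^ t * f t

    private
      S : ℕ → Carrier
      S = partialSum discounted

      upper : ∀ t → discounted t ≤ γ ^ t
      upper t = ≤-resp refl (*-identityʳ _) (*-monoˡ-≤ (0<γ^ t) (proj₂ (f-bounded t)))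

      lower : ∀ t → 0# ≤ discounted t + γ ^ t
      lower t = ≤-resp (zeroʳ _) (trans (distribˡ _ _ _) (+-congˡ (*-identityʳ _)))
        (*-monoˡ-≤ (0<γ^ t)
          (≤-resp (-‿inverseˡ 1#) refl (+-monoˡ-≤ 1# (proj₁ (f-bounded t)))))

      step↓ : ∀ n → d * S (suc n) + γ ^ suc n ≤ d * S n + γ ^ n
      step↓ n = ≤-resp
        (identity₅ γ d (S n) (discounted n) (γ ^ n))
        (trans (identity₆ γ d (S n) (γ ^ n))
               (+-congˡ ([γ+d]* _)))
        (+-monoʳ-≤ _ (*-monoˡ-≤ 0<d (upper n)))

      step↑ : ∀ n → d * S n + γ ^ suc n ≤ d * S (suc n) + γ ^ n
      step↑ n = ≤-resp
        (trans (+-congˡ (zeroʳ d)) (+-identityʳ _))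
        (trans (identity₇ γ d (S n) (discounted n) (γ ^ n))
               (+-congˡ ([γ+d]* _)))
        (+-monoʳ-≤ _ (*-monoˡ-≤ 0<d (lower n)))

      mono↓ : ∀ {m n} → m ℕ.≤′ n → d * S n + γ ^ n ≤ d * S m + γ ^ m
      mono↓ (ℕ.≤′-reflexive ≡.refl) = ≤-reflexive refl
      mono↓ (ℕ.≤′-step m≤n)         = ≤-trans (step↓ _) (mono↓ m≤n)

      mono↑ : ∀ {m n} → m ℕ.≤′ n → d * S m + γ ^ n ≤ d * S n + γ ^ m
      mono↑ (ℕ.≤′-reflexive ≡.refl) = ≤-reflexive refl
      mono↑ {m} {suc n} (ℕ.≤′-step m≤n) r = ≤-trans
        (+-monoˡ-≤ (d * S n + γ ^ suc n) (mono↑ m≤n))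
        (+-monoʳ-≤ (d * S n + γ ^ m) (step↑ n))
        (<-resp
          (identity₈ (d * S n) (γ ^ n) (γ ^ m) (d * S (suc n)))
          (identity₉ (d * S n) (γ ^ n) (γ ^ suc n) (d * S m))
          (+-monoˡ-< (d * S n + γ ^ n) r))

    private
      close : ∀ {ε} N → γ ^ N + γ ^ N < d * ε →
              ∀ m n → N ℕ.≤ m → N ℕ.≤ n → d * S n < d * (S m + ε)
      close {ε} N 2p<dε m n N≤m N≤n = <-trans step₁ (<-trans step₂ step₃)
        where
        p = γ ^ N
        step₁ : d * S n < d * S N + p
        step₁ = <-≤-trans (x<x+y (d * S n) (0<γ^ n)) (mono↓ {N} {n} (≤⇒≤′ N≤n))
        step₂ : d * S N + p < (d * S m + p) + p
        step₂ = +-monoˡ-< p (<-≤-trans (x<x+y (d * S N) (0<γ^ m)) (mono↑ {N} {m} (≤⇒≤′ N≤m)))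
        step₃ : (d * S m + p) + p < d * (S m + ε)
        step₃ = <-resp (sym (+-assoc (d * S m) p p)) (sym (distribˡ d (S m) ε))
          (+-monoʳ-< (d * S m) 2p<dε)

    -- Abstract: unfolding this proof is never needed and very expensive.
    abstract
      discounted-cauchy : Cauchy (partialSum discounted)
      discounted-cauchy 0<ε =
        let N , 2p<dε = γ^-small (*-pos 0<d 0<ε)
        in  N , λ N≤m N≤n → *-cancelˡ-< 0<d (close N 2p<dε _ _ N≤m N≤n)

    discountedSum : Carrier
    discountedSum = Σ∞ discounted discounted-cauchy

------------------------------------------------------------------------
-- Finite simple graphs and trees

record Graph (n : ℕ) : Set₁ where
  infix 4 _~_ _~?_
  field
    _~_      : Rel (Fin n) 0ℓ
    _~?_     : Decidable _~_
    ~-sym    : Symmetric _~_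
    ~-irrefl : ∀ {v} → ¬ (v ~ v)

  N[_] : Fin n → Pred (Fin n) 0ℓ
  N[ x ] v = v ≡ x ⊎ x ~ v

  Connected : Set
  Connected = ∀ u v → Star _~_ u v

  -- A cycle: 3 + length-3 distinct vertices, cyclically adjacent.
  record Cycle : Set where
    field
      length-3 : ℕ
      vertex   : Fin (3 ℕ.+ length-3) → Fin n
      distinct : Injective _≡_ _≡_ vertex
      adjacent : ∀ i → vertex (inject₁ i) ~ vertex (suc i)
      closing  : vertex (fromℕ (2 ℕ.+ length-3)) ~ vertex zero

  IsTree : Set
  IsTree = Connected × ¬ Cycle

------------------------------------------------------------------------
-- The game

Player : Set
Player = Fin 3

pattern P₁ = zero
pattern P₂ = suc zero
pattern P₃ = suc (suc zero)

next : Player → Player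
next P₁ = P₂
next P₂ = P₃
next P₃ = P₁

module Game {n : ℕ} (G : Graph n) where

  open Graph G

  V : Set
  V = Fin n

  -- (x¹ , x² , x³) and the player to move.
  S : Set
  S = Vec V 3 × Player

  data State : Set where
    inS : S → State
    s̄   : State

  S̃¹ S̃² S-C S-NC : Pred S 0ℓ
  S̃¹ (x , _) = lookup x P₁ ≡ lookup x P₂
  S̃² (x , _) = lookup x P₂ ≡ lookup x P₃
  S-C  s = S̃¹ s ⊎ S̃² s
  S-NC s = ¬ S-C s

  S̃¹? : ∀ s → Dec (S̃¹ s)
  S̃¹? (x , _) = lookup x P₁ ≟ lookup x P₂

  S̃²? : ∀ s → Dec (S̃² s)
  S̃²? (x , _) = lookup x P₂ ≟ lookup x P₃

  S-C? : ∀ s → Dec (S-C s)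
  S-C? s = S̃¹? s ⊎-dec S̃²? s

  data Action : Set where
    λ-null : Action
    to     : V → Action

  -- The action sets: A m s a means a ∈ Aᵐ(s).
  data A (m : Player) : State → Pred Action 0ℓ where
    move     : ∀ {x p v} → S-NC (x , p) → m ≡ p → N[ lookup x p ] v →
               A m (inS (x , p)) (to v)
    stay     : ∀ {x p} → S-NC (x , p) → m ≢ p →
               A m (inS (x , p)) (to (lookup x m))
    captured : ∀ {s} → S-C s → A m (inS s) λ-null
    terminal : A m s̄ λ-null

  -- In S-NC only actions `to v` are available, so the value at λ-null there
  -- is immaterial.
  T : State → Action → State
  T s̄             _ = s̄
  T (inS (x , p)) a with S-C? (x , p) | a
  ... | yes _ | _      = s̄
  ... | no  _ | λ-null = s̄
  ... | no  _ | to v   = inS (x [ p ]≔ v , next p)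

  -- Finite histories, most recent state first: the head of sₜ ∷ … ∷ s₀ is
  -- the current state sₜ.
  History : Set
  History = List⁺ State

  Strategy : Player → Set
  Strategy m = (h : History) → ∃[ a ] A m (head h) a

  Profile : Set
  Profile = ∀ m → Strategy m

  -- (σᵐ , σ̂⁻ᵐ) is  σ̂ [ m ↦ σᵐ ].
  _[_↦_] : Profile → (m : Player) → Strategy m → Profile
  (σ [ m ↦ τ ]) k with k ≟ m
  ... | yes ≡.refl = τ
  ... | no  _      = σ k

  -- In S-C the mover's action is necessarily λ-null.
  chosenAction : Profile → History → Action
  chosenAction σ h with head h
  ... | inS (_ , p) = proj₁ (σ p h)
  ... | s̄           = λ-null

  playHistory : S → Profile → ℕ → History
  playHistory s₀ σ zero    = [ inS s₀ ]
  playHistory s₀ σ (suc t) = T (head h) (chosenAction σ h) ∷⁺ h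
    where h = playHistory s₀ σ t

  play : S → Profile → ℕ → State
  play s₀ σ t = head (playHistory s₀ σ t)

  module Payoff {c ℓ₁ ℓ₂} (ℝ : RealField c ℓ₁ ℓ₂)
                (γ : RealField.Carrier ℝ)
                (0<γ : RealField._<_ ℝ (RealField.0# ℝ) γ)
                (γ<1 : RealField._<_ ℝ γ (RealField.1# ℝ)) where

    open RealField ℝ

    q : Player → State → Carrier
    q _  s̄       = 0#
    q P₁ (inS s) = if does (S̃¹? s) then 1# else 0#
    q P₂ (inS s) = if does (S̃¹? s) then - 1# else
                   if does (S̃²? s) then 1# else 0#
    q P₃ (inS s) = if does (S̃¹? s) then 0# else
                   if does (S̃²? s) then - 1# else 0#

    q-bounded : ∀ m s → - 1# ≤ q m s × q m s ≤ 1#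
    q-bounded m  s̄       = RealProperties.0-bounded ℝ
    q-bounded P₁ (inS s) with does (S̃¹? s)
    ... | true  = RealProperties.1-bounded ℝ
    ... | false = RealProperties.0-bounded ℝ
    q-bounded P₂ (inS s) with does (S̃¹? s) | does (S̃²? s)
    ... | true  | _     = RealProperties.-1-bounded ℝ
    ... | false | true  = RealProperties.1-bounded ℝ
    ... | false | false = RealProperties.0-bounded ℝ
    q-bounded P₃ (inS s) with does (S̃¹? s) | does (S̃²? s)
    ... | true  | _     = RealProperties.0-bounded ℝ
    ... | false | true  = RealProperties.-1-bounded ℝ
    ... | false | false = RealProperties.0-bounded ℝ

    -- Q m s₀ σ = Σₜ γᵗ qᵐ(sₜ)
    Q : Player → S → Profile → Carrier
    Q m s₀ σ = Discounting.discountedSum ℝ γ 0<γ γ<1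
      (λ t → q m (play s₀ σ t)) (λ t → q-bounded m (play s₀ σ t))

    IsNashEquilibrium : S → Profile → Set ℓ₂
    IsNashEquilibrium s₀ σ̂ =
      ∀ m (τ : Strategy m) → Q m s₀ σ̂ ≥ Q m s₀ (σ̂ [ m ↦ τ ])

    -- The graph of the capture function: K₃ s₀ σ k means K₃(G|s₀,σ) = k.
    -- Which case holds is not decidable for arbitrary strategies.
    data K₃ (s₀ : S) (σ : Profile) : ℕ → Set (ℓ₁ ⊔ ℓ₂) where
      K≡0 : Q P₁ s₀ σ ≈ 0# → Q P₂ s₀ σ ≈ 0# → Q P₃ s₀ σ ≈ 0# → K₃ s₀ σ 0
      K≡1 : Q P₁ s₀ σ > 0# → K₃ s₀ σ 1
      K≡2 : Q P₂ s₀ σ > 0# → K₃ s₀ σ 2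

{-# OPTIONS --safe #-}

-- For each player m consider the zero-sum game of m against the coalition of the other two.
-- Value iteration for it stabilises, which gives m an optimal positional strategy and the
-- coalition an optimal positional punishment.  In the equilibrium everybody plays his own
-- optimal strategy, except that P₁ simply chases P₂ along the tree while he cannot force a
-- capture; whoever deviates first is punished forever after.  A deviation yields at most the
-- value of the deviator's zero-sum game, and the main line yields at least that: this holds
-- for P₁ while he chases because his payoff is never negative.  The main line ends in a
-- capture, since either P₁ forces one or, in a chase, the branch of the tree in which P₂ is
-- confined shrinks with every move of P₁.

module Submission where

open import Defs
open import Data.Nat.Base using (ℕ) renaming (_>_ to _>ℕ_)
open import Data.Product.Base using (∃-syntax; _×_)

open import Algebra.Bundles using (CommutativeRing; CommutativeSemiring)
import Algebra.Properties.Ring as RingProperties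
import Algebra.Solver.Ring.NaturalCoefficients.Default as Solver
open import Data.Bool.Base using (Bool; true; false; if_then_else_)
open import Data.Fin.Base using (Fin; zero; suc; inject₁; fromℕ)
open import Data.Fin.Properties using (_≟_)
open import Data.List.Base as List
  using (List; []; _∷_; length; filter; allFin; cartesianProduct; cartesianProductWith)
import Data.List.Extrema as Extrema
open import Data.List.Membership.DecPropositional using () renaming (_∈?_ to ∈-dec)
open import Data.List.Membership.Propositional using (_∈_)
open import Data.List.Membership.Propositional.Properties
  using (∈-allFin; ∈-lookup; ∈-filter⁺; ∈-cartesianProduct⁺; ∈-cartesianProductWith⁺)
open import Data.List.NonEmpty using (_∷_; head; tail)
open import Data.List.Relation.Unary.All as All using (All; []; _∷_)
open import Data.List.Relation.Unary.All.Properties using (all-filter; ¬Any⇒All¬)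
open import Data.List.Relation.Unary.AllPairs using ([]; _∷_)
open import Data.List.Relation.Unary.Any using (here; there)
open import Data.List.Relation.Unary.Unique.Propositional using (Unique)
open import Data.Maybe.Base using (Maybe; just; nothing)
open import Data.Nat.Base as ℕ using (zero; suc)
import Data.Nat.Properties as ℕ
open import Data.Product.Base using (_,_; proj₁; proj₂)
import Data.Product.Properties as Product
open import Data.Sum.Base as Sum using (_⊎_; inj₁; inj₂)
open import Data.Unit.Base using (⊤; tt)
open import Data.Vec.Base using ([]; _∷_; lookup; _[_]≔_)
import Data.Vec.Properties as Vec
open import Function.Base using (_∘_)
open import Level using (0ℓ)
open import Relation.Binary.Bundles using (TotalOrder)
open import Relation.Binary.Construct.Closure.ReflexiveTransitive as Star
  using (Star; ε; _◅_; _◅◅_)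
import Relation.Binary.Construct.Flip.EqAndOrd as Flip
open import Relation.Binary.Core using (Rel)
open import Relation.Binary.Definitions using (DecidableEquality)
open import Relation.Binary.PropositionalEquality
  using (_≡_; _≢_; refl; sym; trans; cong; cong₂; subst; ≢-sym; isEquivalence)
open import Relation.Binary.Structures using (IsTotalOrder)
open import Relation.Nullary using (Dec; yes; no; does; contradiction)
open import Relation.Nullary.Decidable
  using (_×-dec_; _⊎-dec_; ¬?; map′; toSum; dec-true; dec-false; decidable-stable)
open import Relation.Unary using (Pred; Decidable; _⊆_)

-- Counting the elements that satisfy a predicate

-- Both termination arguments, for value iteration and for the chase, rest on this dichotomy: a
-- stronger predicate either agrees with the weaker one throughout the list or holds strictly less
-- often.
filter-shrinks : ∀ {a p q} {X : Set a} {P : Pred X p} {Q : Pred X q}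
  (P? : Decidable P) (Q? : Decidable Q) → P ⊆ Q → ∀ xs →
  All (λ x → Q x → P x) xs ⊎ length (filter P? xs) ℕ.< length (filter Q? xs)
filter-shrinks P? Q? P⊆Q [] = inj₁ []
filter-shrinks P? Q? P⊆Q (x ∷ xs) with P? x | Q? x | filter-shrinks P? Q? P⊆Q xs
... | yes p | no ¬q | _            = contradiction (P⊆Q p) ¬q
... | yes p | yes _ | inj₁ Q⇒P     = inj₁ ((λ _ → p) ∷ Q⇒P)
... | yes _ | yes _ | inj₂ fewer   = inj₂ (ℕ.s≤s fewer)
... | no _  | no ¬q | inj₁ Q⇒P     = inj₁ ((λ q → contradiction q ¬q) ∷ Q⇒P)
... | no _  | no _  | inj₂ fewer   = inj₂ fewer
... | no _  | yes _ | inj₂ fewer   = inj₂ (ℕ.m<n⇒m<1+n fewer)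
... | no _  | yes _ | inj₁ Q⇒P     = inj₂ (ℕ.s≤s (≤-length Q⇒P))
  where
  ≤-length : ∀ {xs} → All (λ x → _ → _) xs →
             length (filter P? xs) ℕ.≤ length (filter Q? xs)
  ≤-length {[]}     _ = ℕ.z≤n
  ≤-length {x ∷ xs} (_ ∷ h) with P? x | Q? x
  ... | yes _ | yes _ = ℕ.s≤s (≤-length h)
  ... | yes p | no ¬q = contradiction (P⊆Q p) ¬q
  ... | no _  | yes _ = ℕ.m≤n⇒m≤1+n (≤-length h)
  ... | no _  | no _  = ≤-length h

-- Branches of a tree

lookup-injective : ∀ {a} {X : Set a} {xs : List X} → Unique xs →
  ∀ {i j} → List.lookup xs i ≡ List.lookup xs j → i ≡ j
lookup-injective (x∉ ∷ _) {zero}  {zero}  _  = refl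
lookup-injective (x∉ ∷ _) {zero}  {suc j} eq = contradiction eq (All.lookup x∉ (∈-lookup j))
lookup-injective (x∉ ∷ _) {suc i} {zero}  eq = contradiction (sym eq) (All.lookup x∉ (∈-lookup i))
lookup-injective (_ ∷ u)  {suc i} {suc j} eq = cong suc (lookup-injective u eq)

module Tree {n : ℕ} (G : Graph n) (isTree : Graph.IsTree G) where

  open Graph G

  private
    V : Set
    V = Fin n

  ~⇒≢ : ∀ {u v} → u ~ v → u ≢ v
  ~⇒≢ u~v refl = ~-irrefl u~v

  -- The relation is a parameter so that the construction nests: a walk that already avoids one
  -- vertex can be cut at another by `lastVisit`.
  Outside : V → Rel V 0ℓ → Rel V 0ℓ
  Outside x R u v = R u v × u ≢ x × v ≢ x

  Avoiding : V → Rel V 0ℓ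
  Avoiding x = Outside x _~_

  avoiding-reverse : ∀ {x u v} → Star (Avoiding x) u v → Star (Avoiding x) v u
  avoiding-reverse = Star.reverse λ (u~v , u≢x , v≢x) → ~-sym u~v , v≢x , u≢x

  lastVisit : ∀ {R : Rel V 0ℓ} x {u y} → y ≢ x → Star R u y →
    (u ≢ x × Star (Outside x R) u y) ⊎
    (∃[ a ] R x a × a ≢ x × Star (Outside x R) a y)
  lastVisit x y≢x ε = inj₁ (y≢x , ε)
  lastVisit x {u} y≢x (r ◅ rs) with lastVisit x y≢x rs | u ≟ x
  ... | inj₂ found     | _        = inj₂ found
  ... | inj₁ (v≢x , w) | yes refl = inj₂ (_ , r , v≢x , w)
  ... | inj₁ (v≢x , w) | no u≢x   = inj₁ (u≢x , (r , u≢x , v≢x) ◅ w)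

  -- Walk u b vs is a walk u ∷ vs ending in b.
  data Walk : V → V → List V → Set where
    done : ∀ {b} → Walk b b []
    _∷_  : ∀ {u v b vs} → u ~ v → Walk v b vs → Walk u b (v ∷ vs)

  walk-adjacent : ∀ {u b vs} → Walk u b vs → ∀ i →
    List.lookup (u ∷ vs) (inject₁ i) ~ List.lookup (u ∷ vs) (suc i)
  walk-adjacent (u~v ∷ _) zero    = u~v
  walk-adjacent (_ ∷ w)   (suc i) = walk-adjacent w i

  walk-end : ∀ {u b vs} → Walk u b vs → List.lookup (u ∷ vs) (fromℕ (length vs)) ≡ b
  walk-end done    = refl
  walk-end (_ ∷ w) = walk-end w

  walk-suffix : ∀ {x a v b vs} → a ∈ (v ∷ vs) → Walk v b vs → Unique (x ∷ v ∷ vs) →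
    ∃[ ws ] Walk a b ws × Unique (x ∷ a ∷ ws)
  walk-suffix (here refl) w u = _ , w , u
  walk-suffix (there a∈)  (_ ∷ w) ((_ ∷ x∉) ∷ _ ∷ u) = walk-suffix a∈ w (x∉ ∷ u)

  -- Whenever a vertex recurs, the loop it closes is dropped. The avoided vertex `x` is kept in the
  -- `Unique` list so that a walk between two distinct neighbours of `x` closes up to a cycle
  -- through `x`.
  loopErase : ∀ {x a b} → a ≢ x → Star (Avoiding x) a b →
    ∃[ vs ] Walk a b vs × Unique (x ∷ a ∷ vs)
  loopErase a≢x ε = [] , done , (≢-sym a≢x ∷ []) ∷ [] ∷ []
  loopErase {x} {a} a≢x ((a~v , _ , v≢x) ◅ rest) with loopErase v≢x rest
  ... | vs , w , u@(x∉ ∷ u′) with ∈-dec _≟_ a (_ ∷ vs)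
  ...   | yes a∈ = walk-suffix a∈ w u
  ...   | no  a∉ = _ , a~v ∷ w , (≢-sym a≢x ∷ x∉) ∷ ¬Any⇒All¬ _ a∉ ∷ u′

  -- The only use of acyclicity.
  neighbours-separated : ∀ {x a b} → x ~ a → x ~ b → Star (Avoiding x) a b → a ≡ b
  neighbours-separated x~a x~b a⇝b with loopErase (≢-sym (~⇒≢ x~a)) a⇝b
  ... | _ , done , _ = refl
  ... | _ , w@(_ ∷ _) , u = contradiction cycle (proj₂ isTree)
    where
    cycle : Cycle
    cycle = record
      { length-3 = _
      ; vertex   = List.lookup _
      ; distinct = lookup-injective u
      ; adjacent = walk-adjacent (x~a ∷ w)
      ; closing  = subst (_~ _) (sym (walk-end (x~a ∷ w))) (~-sym x~b)
      }

  Toward : V → V → V → Set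
  Toward x y a = x ~ a × Star (Avoiding x) a y

  toward-unique : ∀ {x y a b} → Toward x y a → Toward x y b → a ≡ b
  toward-unique (x~a , a⇝y) (x~b , b⇝y) =
    neighbours-separated x~a x~b (a⇝y ◅◅ avoiding-reverse b⇝y)

  toward-exists : ∀ {x y} → x ≢ y → ∃[ a ] Toward x y a
  toward-exists {x} {y} x≢y with lastVisit x (≢-sym x≢y) (proj₁ isTree x y)
  ... | inj₁ (x≢x , _)         = contradiction refl x≢x
  ... | inj₂ (a , x~a , _ , w) = a , x~a , w

  step : V → V → V
  step x y with x ≟ y
  -- Staying put is a placeholder that keeps the move legal; the directional properties all concern
  -- distinct vertices.
  ... | yes _  = x
  ... | no x≢y = proj₁ (toward-exists x≢y)

  step-toward : ∀ {x y} → x ≢ y → Toward x y (step x y)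
  step-toward {x} {y} x≢y with x ≟ y
  ... | yes x≡y = contradiction x≡y x≢y
  ... | no x≢y′ = proj₂ (toward-exists x≢y′)

  toward⇒step : ∀ {x y a} → x ≢ y → Toward x y a → step x y ≡ a
  toward⇒step x≢y = toward-unique (step-toward x≢y)

  step-legal : ∀ x y → N[ x ] (step x y)
  step-legal x y with x ≟ y
  ... | yes _  = inj₁ refl
  ... | no x≢y = inj₂ (proj₁ (proj₂ (toward-exists x≢y)))

  -- The edge from `y` to `y′` survives the deletion of `x`, so both ends lie in the same component.
  step-constant : ∀ {x y y′} → x ≢ y → x ≢ y′ → N[ y ] y′ → step x y′ ≡ step x y
  step-constant _ _ (inj₁ refl) = refl
  step-constant x≢y x≢y′ (inj₂ y~y′) with step-toward x≢y
  ... | x~a , a⇝y = toward⇒step x≢y′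
          (x~a , a⇝y ◅◅ (y~y′ , ≢-sym x≢y , ≢-sym x≢y′) ◅ ε)

  -- If the way from `a` to `y` went through `x`, it would continue without meeting `a`. Its last
  -- departure from `x` would then lead to a second neighbour of `x` from which `y` is reached off
  -- `x`, against `toward-unique`.
  step-no-return : ∀ {x y a} → x ≢ y → a ≢ y → Toward x y a → step a y ≢ x
  step-no-return {x} {y} x≢y a≢y x→y eq with subst (Toward _ y) eq (step-toward a≢y)
  ... | _ , x⇝y with lastVisit x (≢-sym x≢y) x⇝y
  ...   | inj₁ (x≢x , _) = x≢x refl
  ...   | inj₂ (b , (x~b , _ , b≢a) , _ , b⇝y) =
          b≢a (toward-unique (x~b , Star.map (λ ((r , _) , o) → r , o) b⇝y) x→y)

  -- Take the walk from `a` to `z` that never returns to `a`. If it misses `x`, it shows that `x`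
  -- sees `z` through `a`; if it meets `x`, its part from the last visit on shows that `step a z` is
  -- `x`.
  step-extends : ∀ {x a z} → x ~ a → a ≢ z → step a z ≢ x → x ≢ z × step x z ≡ a
  step-extends {x} {a} {z} x~a a≢z az≢x = x≢z , x→z
    where
    x≢z : x ≢ z
    x≢z refl = az≢x (toward⇒step a≢z (~-sym x~a , ε))

    x→z : step x z ≡ a
    x→z with step-toward a≢z
    ... | a~w , w⇝z with lastVisit x (≢-sym x≢z) w⇝z
    ...   | inj₁ (w≢x , w⇝z′) = toward⇒step x≢z
              (x~a , (a~w , ≢-sym (~⇒≢ x~a) , w≢x) ◅ Star.map (λ ((r , _) , o) → r , o) w⇝z′)
    ...   | inj₂ (b , x→b , _ , b⇝z) = contradiction
              (toward⇒step a≢z (~-sym x~a , x→b ◅ Star.map proj₁ b⇝z)) az≢x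

  -- For a neighbour `a` of `x` this is the component of `a` in the tree with `x` deleted.
  Branch : V → V → Pred V 0ℓ
  Branch x a z = x ≢ z × step x z ≡ a

  branch? : ∀ x a → Decidable (Branch x a)
  branch? x a z = ¬? (x ≟ z) ×-dec (step x z ≟ a)

  branchSize : V → V → ℕ
  branchSize x a = length (filter (branch? x a) (allFin n))

  -- By `step-extends` and `step-no-return` the branch ahead of the pursuer's new vertex is part of
  -- the old one, and that vertex itself has dropped out.
  branchSize-decreases : ∀ {x y} → x ≢ y → step x y ≢ y →
    branchSize (step x y) (step (step x y) y) ℕ.< branchSize x (step x y)
  branchSize-decreases {x} {y} x≢y a≢y
    with filter-shrinks (branch? a (step a y)) (branch? x a) shrinks (allFin n)
    where
    a = step x y
    shrinks : Branch a (step a y) ⊆ Branch x a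
    shrinks (a≢z , eq) = step-extends (proj₁ (step-toward x≢y)) a≢z
      (step-no-return x≢y a≢y (step-toward x≢y) ∘ trans (sym eq))
  ... | inj₂ fewer = fewer
  ... | inj₁ same  = contradiction refl
          (proj₁ (All.lookup same (∈-allFin (step x y)) (x≢a , toward⇒step x≢a (x~a , ε))))
    where
    x~a = proj₁ (step-toward x≢y)
    x≢a = ~⇒≢ x~a

-- Outcomes

-- win k, draw and lose k stand for the payoffs γᵏ, 0 and - γᵏ.
data Outcome : Set where
  win lose : ℕ → Outcome
  draw     : Outcome

draw? : ∀ o → Dec (o ≡ draw)
draw? (win _)  = no λ ()
draw? (lose _) = no λ ()
draw? draw     = yes refl

infix 4 _⊑_
data _⊑_ : Rel Outcome 0ℓ where
  lose⊑lose : ∀ {j k} → j ℕ.≤ k → lose j ⊑ lose k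
  lose⊑draw : ∀ {j} → lose j ⊑ draw
  lose⊑win  : ∀ {j k} → lose j ⊑ win k
  draw⊑draw : draw ⊑ draw
  draw⊑win  : ∀ {k} → draw ⊑ win k
  win⊑win   : ∀ {j k} → k ℕ.≤ j → win j ⊑ win k

⊑-refl : ∀ {o} → o ⊑ o
⊑-refl {win _}  = win⊑win ℕ.≤-refl
⊑-refl {lose _} = lose⊑lose ℕ.≤-refl
⊑-refl {draw}   = draw⊑draw

⊑-reflexive : ∀ {o o′} → o ≡ o′ → o ⊑ o′
⊑-reflexive refl = ⊑-refl

⊑-trans : ∀ {o o′ o″} → o ⊑ o′ → o′ ⊑ o″ → o ⊑ o″
⊑-trans (lose⊑lose p) (lose⊑lose q) = lose⊑lose (ℕ.≤-trans p q)
⊑-trans (lose⊑lose _) lose⊑draw     = lose⊑draw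
⊑-trans (lose⊑lose _) lose⊑win      = lose⊑win
⊑-trans lose⊑draw     draw⊑draw     = lose⊑draw
⊑-trans lose⊑draw     draw⊑win      = lose⊑win
⊑-trans lose⊑win      (win⊑win _)   = lose⊑win
⊑-trans draw⊑draw     q             = q
⊑-trans draw⊑win      (win⊑win _)   = draw⊑win
⊑-trans (win⊑win p)   (win⊑win q)   = win⊑win (ℕ.≤-trans q p)

⊑-antisym : ∀ {o o′} → o ⊑ o′ → o′ ⊑ o → o ≡ o′
⊑-antisym (lose⊑lose p) (lose⊑lose q) = cong lose (ℕ.≤-antisym p q)
⊑-antisym draw⊑draw     draw⊑draw     = refl
⊑-antisym (win⊑win p)   (win⊑win q)   = cong win (ℕ.≤-antisym q p)

⊑-total : ∀ o o′ → o ⊑ o′ ⊎ o′ ⊑ o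
⊑-total (win j)  (win k)  = Sum.map win⊑win win⊑win (ℕ.≤-total k j)
⊑-total (win _)  (lose _) = inj₂ lose⊑win
⊑-total (win _)  draw     = inj₂ draw⊑win
⊑-total (lose _) (win _)  = inj₁ lose⊑win
⊑-total (lose j) (lose k) = Sum.map lose⊑lose lose⊑lose (ℕ.≤-total j k)
⊑-total (lose _) draw     = inj₁ lose⊑draw
⊑-total draw     (win _)  = inj₁ draw⊑win
⊑-total draw     (lose _) = inj₂ lose⊑draw
⊑-total draw     draw     = inj₁ draw⊑draw

⊑-isTotalOrder : IsTotalOrder _≡_ _⊑_
⊑-isTotalOrder = record
  { isPartialOrder = record
    { isPreorder = record
      { isEquivalence = isEquivalence ; reflexive = ⊑-reflexive ; trans = ⊑-trans }
    ; antisym = ⊑-antisym }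
  ; total = ⊑-total }

delay : Outcome → Outcome
delay (win k)  = win (suc k)
delay (lose k) = lose (suc k)
delay draw     = draw

delay-mono : ∀ {o o′} → o ⊑ o′ → delay o ⊑ delay o′
delay-mono (lose⊑lose p) = lose⊑lose (ℕ.s≤s p)
delay-mono lose⊑draw     = lose⊑draw
delay-mono lose⊑win      = lose⊑win
delay-mono draw⊑draw     = draw⊑draw
delay-mono draw⊑win      = draw⊑win
delay-mono (win⊑win p)   = win⊑win (ℕ.s≤s p)

-- The outcome seen with horizon `N`: a capture later than time `N` counts as a draw.
truncate : ℕ → Outcome → Outcome
truncate _       draw           = draw
truncate _       (win zero)     = win zero
truncate _       (lose zero)    = lose zero
truncate zero    (win (suc _))  = draw
truncate zero    (lose (suc _)) = draw
truncate (suc N) (win (suc k))  = delay (truncate N (win k))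
truncate (suc N) (lose (suc k)) = delay (truncate N (lose k))

truncate-delay : ∀ N o → truncate (suc N) (delay o) ≡ delay (truncate N o)
truncate-delay N (win _)  = refl
truncate-delay N (lose _) = refl
truncate-delay N draw     = refl

truncate-zero-delay : ∀ o → truncate zero (delay o) ≡ draw
truncate-zero-delay (win _)  = refl
truncate-zero-delay (lose _) = refl
truncate-zero-delay draw     = refl

draw⊑truncate-win : ∀ N k → draw ⊑ truncate N (win k)
draw⊑truncate-win _       zero    = draw⊑win
draw⊑truncate-win zero    (suc _) = draw⊑draw
draw⊑truncate-win (suc N) (suc k) = delay-mono (draw⊑truncate-win N k)

truncate-lose⊑draw : ∀ N k → truncate N (lose k) ⊑ draw
truncate-lose⊑draw _       zero    = lose⊑draw
truncate-lose⊑draw zero    (suc _) = draw⊑draw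
truncate-lose⊑draw (suc N) (suc k) = delay-mono (truncate-lose⊑draw N k)

lose-zero⊑ : ∀ o → lose zero ⊑ o
lose-zero⊑ (win _)  = lose⊑win
lose-zero⊑ (lose _) = lose⊑lose ℕ.z≤n
lose-zero⊑ draw     = lose⊑draw

⊑win-zero : ∀ o → o ⊑ win zero
⊑win-zero (win _)  = win⊑win ℕ.z≤n
⊑win-zero (lose _) = lose⊑win
⊑win-zero draw     = draw⊑win

-- The outcomes replaced are the latest captures, which are those nearest to `draw` on either side,
-- so the order survives.
truncate-mono : ∀ N {o o′} → o ⊑ o′ → truncate N o ⊑ truncate N o′
truncate-mono N (lose⊑draw {j}) = truncate-lose⊑draw N j
truncate-mono N (lose⊑win {j} {k}) =
  ⊑-trans (truncate-lose⊑draw N j) (draw⊑truncate-win N k)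
truncate-mono N draw⊑draw = draw⊑draw
truncate-mono N (draw⊑win {k}) = draw⊑truncate-win N k
truncate-mono N       (lose⊑lose ℕ.z≤n)     = lose-zero⊑ _
truncate-mono zero    (lose⊑lose (ℕ.s≤s _)) = draw⊑draw
truncate-mono (suc N) (lose⊑lose (ℕ.s≤s p)) = delay-mono (truncate-mono N (lose⊑lose p))
truncate-mono N       (win⊑win ℕ.z≤n)       = ⊑win-zero _
truncate-mono zero    (win⊑win (ℕ.s≤s _))   = draw⊑draw
truncate-mono (suc N) (win⊑win (ℕ.s≤s p))   = delay-mono (truncate-mono N (win⊑win p))

truncate-suc : ∀ {N o} → truncate 0 o ≡ o → truncate (suc N) o ≡ o
truncate-suc {o = win zero}  _ = refl
truncate-suc {o = lose zero} _ = refl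
truncate-suc {o = draw}      _ = refl

truncate-draw-or-id : ∀ N o → truncate N o ≡ draw ⊎ truncate N o ≡ o
truncate-draw-or-id _       draw           = inj₁ refl
truncate-draw-or-id _       (win zero)     = inj₂ refl
truncate-draw-or-id _       (lose zero)    = inj₂ refl
truncate-draw-or-id zero    (win (suc _))  = inj₁ refl
truncate-draw-or-id zero    (lose (suc _)) = inj₁ refl
truncate-draw-or-id (suc N) (win (suc k))  =
  Sum.map (cong delay) (cong delay) (truncate-draw-or-id N (win k))
truncate-draw-or-id (suc N) (lose (suc k)) =
  Sum.map (cong delay) (cong delay) (truncate-draw-or-id N (lose k))

-- The order to be maximised by the player (true) and by the opposing coalition (false).
infix 4 _⊑[_]_
_⊑[_]_ : Outcome → Bool → Outcome → Set
o ⊑[ true  ] o′ = o ⊑ o′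
o ⊑[ false ] o′ = o′ ⊑ o

⊑[]-isTotalOrder : ∀ b → IsTotalOrder _≡_ _⊑[ b ]_
⊑[]-isTotalOrder true  = ⊑-isTotalOrder
⊑[]-isTotalOrder false = Flip.isTotalOrder ⊑-isTotalOrder

⊑[]-totalOrder : Bool → TotalOrder 0ℓ 0ℓ 0ℓ
⊑[]-totalOrder b = record { isTotalOrder = ⊑[]-isTotalOrder b }

truncate-mono[] : ∀ b N {o o′} → o ⊑[ b ] o′ → truncate N o ⊑[ b ] truncate N o′
truncate-mono[] true  N = truncate-mono N
truncate-mono[] false N = truncate-mono N

-- Values of zero-sum games

-- A coordinate that has left draw is final, so the number of draws strictly decreases until
-- two consecutive approximations agree.
stabilises : ∀ {a} {X : Set a} {xs : List X} → (∀ x → x ∈ xs) → (f : ℕ → X → Outcome) →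
  (∀ N x → f N x ≡ draw ⊎ f N x ≡ f (suc N) x) → ∃[ N ] ∀ x → f (suc N) x ≡ f N x
stabilises {X = X} {xs} complete f settled = go _ 0 ℕ.≤-refl
  where
  draws : ℕ → ℕ
  draws N = length (filter (draw? ∘ f N) xs)

  go : ∀ fuel N → draws N ℕ.≤ fuel → ∃[ N ] ∀ x → f (suc N) x ≡ f N x
  go fuel N bound with filter-shrinks (draw? ∘ f (suc N)) (draw? ∘ f N) stillDraw xs
    where
    stillDraw : ∀ {x} → f (suc N) x ≡ draw → f N x ≡ draw
    stillDraw {x} eq with settled N x
    ... | inj₁ isDraw = isDraw
    ... | inj₂ same   = trans same eq
  ... | inj₁ same = N , agree
    where
    agree : ∀ x → f (suc N) x ≡ f N x
    agree x with settled N x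
    ... | inj₁ isDraw = trans (All.lookup same (complete x) isDraw) (sym isDraw)
    ... | inj₂ eq     = sym eq
  go zero       N bound | inj₂ fewer = contradiction (ℕ.≤-trans fewer bound) λ ()
  go (suc fuel) N bound | inj₂ fewer = go fuel (suc N) (ℕ.s≤s⁻¹ (ℕ.≤-trans fewer bound))

module Values {n : ℕ} (G : Graph n) where

  open Graph G
  open Game G

  mover : S → Player
  mover = proj₂

  Legal : S → Pred V 0ℓ
  Legal (x , p) = N[ lookup x p ]

  legal? : ∀ s → Decidable (Legal s)
  legal? (x , p) v = (v ≟ lookup x p) ⊎-dec (lookup x p ~? v)

  successor : S → V → S
  successor (x , p) v = x [ p ]≔ v , next p

  -- Total, with a move even at captured states; `respond` puts the null action in its place there.
  Policy : Set
  Policy = ∀ s → ∃[ v ] Legal s v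

  allStates : List S
  allStates = cartesianProduct
    (cartesianProductWith _∷_ (allFin n)
      (cartesianProductWith _∷_ (allFin n)
        (cartesianProductWith _∷_ (allFin n) ([] ∷ [])))) (allFin 3)

  ∈-allStates : ∀ s → s ∈ allStates
  ∈-allStates (x ∷ y ∷ z ∷ [] , p) = ∈-cartesianProduct⁺
    (∈-cartesianProductWith⁺ _∷_ (∈-allFin x)
      (∈-cartesianProductWith⁺ _∷_ (∈-allFin y)
        (∈-cartesianProductWith⁺ _∷_ (∈-allFin z) (here refl)))) (∈-allFin p)

  module _ (b : Bool) where

    open TotalOrder (⊑[]-totalOrder b) using (antisym)
    open Extrema (⊑[]-totalOrder b) using (argmax; argmax-all; f[xs]≤f[argmax])

    abstract
      best : (S → Outcome) → S → V
      -- The default of `argmax` is to stay, which is legal. For `b = false` the order is reversed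
      -- and the maximum is a minimum.
      best f s@(x , p) = argmax (f ∘ successor s) (lookup x p) (filter (legal? s) (allFin n))

      best-legal : ∀ (f : S → Outcome) s → Legal s (best f s)
      best-legal f s@(x , p) = argmax-all (f ∘ successor s) {P = Legal s} (inj₁ refl)
        (all-filter (legal? s) (allFin n))

      best-optimal : ∀ (f : S → Outcome) s {v} → Legal s v →
        f (successor s v) ⊑[ b ] f (successor s (best f s))
      best-optimal f s@(x , p) legal = All.lookup
        (f[xs]≤f[argmax] {f = f ∘ successor s} (lookup x p) (filter (legal? s) (allFin n)))
        (∈-filter⁺ (legal? s) (∈-allFin _) legal)

    -- The two best moves may differ; only their values are compared. Each is optimal for its own
    -- function, and truncation is monotone, so antisymmetry applies.
    best-truncate : ∀ N {f g : S → Outcome} → (∀ s → f s ≡ truncate N (g s)) → ∀ s →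
      f (successor s (best f s)) ≡ truncate N (g (successor s (best g s)))
    best-truncate N {f} {g} f≗g s = antisym
      (subst (_⊑[ b ] truncate N (g (successor s (best g s)))) (sym (f≗g _))
        (truncate-mono[] b N {g (successor s (best f s))} (best-optimal g s (best-legal f s))))
      (subst (_⊑[ b ] f (successor s (best f s))) (f≗g _) (best-optimal f s (best-legal g s)))

  finalOutcome : Player → S → Outcome
  finalOutcome P₁ s = if does (S̃¹? s) then win 0 else draw
  finalOutcome P₂ s = if does (S̃¹? s) then lose 0 else
                      if does (S̃²? s) then win 0 else draw
  finalOutcome P₃ s = if does (S̃¹? s) then draw else
                      if does (S̃²? s) then lose 0 else draw

  truncate-finalOutcome : ∀ m s → truncate 0 (finalOutcome m s) ≡ finalOutcome m s
  truncate-finalOutcome P₁ s with does (S̃¹? s)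
  ... | true  = refl
  ... | false = refl
  truncate-finalOutcome P₂ s with does (S̃¹? s) | does (S̃²? s)
  ... | true  | _     = refl
  ... | false | true  = refl
  ... | false | false = refl
  truncate-finalOutcome P₃ s with does (S̃¹? s) | does (S̃²? s)
  ... | true  | _     = refl
  ... | false | true  = refl
  ... | false | false = refl

  finalOutcome-live : ∀ m {s} → S-NC s → finalOutcome m s ≡ draw
  finalOutcome-live P₁ {s} nc
    rewrite dec-false (S̃¹? s) (nc ∘ inj₁) = refl
  finalOutcome-live P₂ {s} nc
    rewrite dec-false (S̃¹? s) (nc ∘ inj₁) | dec-false (S̃²? s) (nc ∘ inj₂) = refl
  finalOutcome-live P₃ {s} nc
    rewrite dec-false (S̃¹? s) (nc ∘ inj₁) | dec-false (S̃²? s) (nc ∘ inj₂) = refl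

  module ZeroSum (m : Player) where

    side : S → Bool
    side s = does (mover s ≟ m)

    resolve : S → Outcome → Outcome
    resolve s o with S-C? s
    ... | yes _ = finalOutcome m s
    ... | no _  = delay o

    resolve-captured : ∀ s o → S-C s → resolve s o ≡ finalOutcome m s
    resolve-captured s o c with S-C? s
    ... | yes _ = refl
    ... | no nc = contradiction c nc

    resolve-live : ∀ s o → S-NC s → resolve s o ≡ delay o
    resolve-live s o nc with S-C? s
    ... | yes c = contradiction c nc
    ... | no _  = refl

    approx : ℕ → S → Outcome
    approx zero    s = finalOutcome m s
    approx (suc N) s = resolve s (approx N (successor s (best (side s) (approx N) s)))

    truncate-resolve-zero : ∀ s o → truncate 0 (resolve s o) ≡ finalOutcome m s
    truncate-resolve-zero s o with S-C? s
    ... | yes _ = truncate-finalOutcome m s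
    ... | no nc = trans (truncate-zero-delay o) (sym (finalOutcome-live m nc))

    truncate-resolve-suc : ∀ N s o → truncate (suc N) (resolve s o) ≡ resolve s (truncate N o)
    truncate-resolve-suc N s o with S-C? s
    ... | yes _ = truncate-suc (truncate-finalOutcome m s)
    ... | no _  = truncate-delay N o

    -- Truncation commutes with delay and with optimisation, so lengthening the horizon only reveals
    -- later captures. Hence an entry can change only from `draw`, which is what `stabilises`
    -- requires.
    approx-truncates : ∀ N s → approx N s ≡ truncate N (approx (suc N) s)
    approx-truncates zero    s = sym (truncate-resolve-zero s _)
    approx-truncates (suc N) s = trans
      (cong (resolve s)
        (best-truncate (side s) N {approx N} {approx (suc N)} (approx-truncates N) s))
      (sym (truncate-resolve-suc N s _))

    abstract
      stable : ∃[ N ] ∀ s → approx (suc N) s ≡ approx N s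
      stable = stabilises ∈-allStates approx λ N s → Sum.map
        (trans (approx-truncates N s)) (trans (approx-truncates N s))
        (truncate-draw-or-id N (approx (suc N) s))

    -- At the stable index a further iteration changes nothing, so `value` solves the optimality
    -- equation of the game with unbounded horizon.
    value : S → Outcome
    value = approx (proj₁ stable)

    optimal : Policy
    optimal s = best (side s) value s , best-legal (side s) value s

    value-captured : ∀ {s} → S-C s → value s ≡ finalOutcome m s
    value-captured {s} c = trans (sym (proj₂ stable s)) (resolve-captured s _ c)

    value-optimal : ∀ {s} → S-NC s → value s ≡ delay (value (successor s (proj₁ (optimal s))))
    value-optimal {s} nc = trans (sym (proj₂ stable s)) (resolve-live s _ nc)

    -- Bounds what a deviator can gain by a move of his own.
    value-own : ∀ {s v} → S-NC s → mover s ≡ m → Legal s v →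
      delay (value (successor s v)) ⊑ value s
    value-own {s} {v} nc own legal =
      ⊑-trans (delay-mono bound) (⊑-reflexive (sym (value-optimal nc)))
      where
      bound : value (successor s v) ⊑ value (successor s (proj₁ (optimal s)))
      bound with mover s ≟ m
      ... | yes _     = best-optimal true value s legal
      ... | no  other = contradiction own other

    -- Protects `m` on the main line, where the others pursue their own aims instead of minimising
    -- his payoff.
    value-other : ∀ {s v} → S-NC s → mover s ≢ m → Legal s v →
      value s ⊑ delay (value (successor s v))
    value-other {s} {v} nc other legal =
      ⊑-trans (⊑-reflexive (value-optimal nc)) (delay-mono bound)
      where
      bound : value (successor s (proj₁ (optimal s))) ⊑ value (successor s v)
      bound with mover s ≟ m
      ... | yes own = contradiction own other
      ... | no _    = best-optimal false value s legal

-- The main line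

win⊑delay : ∀ {k o} → win k ⊑ delay o → ∃[ j ] k ≡ suc j × win j ⊑ o
win⊑delay {o = win _} (win⊑win (ℕ.s≤s p)) = _ , refl , win⊑win p

win-or-⊑draw : ∀ o → (∃[ k ] win k ⊑ o) ⊎ o ⊑ draw
win-or-⊑draw (win k)  = inj₁ (k , ⊑-refl)
win-or-⊑draw (lose _) = inj₂ lose⊑draw
win-or-⊑draw draw     = inj₂ draw⊑draw

module MainPlay {n : ℕ} (G : Graph n) (isTree : Graph.IsTree G) where

  open Graph G
  open Game G
  open Tree G isTree
  open Values G
  open ZeroSum

  lead : Outcome → ∀ x → ∃[ v ] Legal (x , P₁) v
  lead (win _)  x = optimal P₁ (x , P₁)
  lead (lose _) x = step (lookup x P₁) (lookup x P₂) , step-legal (lookup x P₁) (lookup x P₂)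
  lead draw     x = step (lookup x P₁) (lookup x P₂) , step-legal (lookup x P₁) (lookup x P₂)

  lead-win : ∀ {k o} x → win k ⊑ o → lead o x ≡ optimal P₁ (x , P₁)
  lead-win x (win⊑win _) = refl

  lead-chase : ∀ {o} x → o ⊑ draw → proj₁ (lead o x) ≡ step (lookup x P₁) (lookup x P₂)
  lead-chase x lose⊑draw = refl
  lead-chase x draw⊑draw = refl

  -- If P₁ cannot force a capture, any move is optimal in his zero-sum game; chasing
  -- P₂ makes sure that somebody is captured.
  main : Policy
  main s@(x , P₁) = lead (value P₁ s) x
  main s@(_ , P₂) = optimal P₂ s
  main s@(_ , P₃) = optimal P₃ s

  advance : S → S
  advance s = successor s (proj₁ (main s))

  -- Inductive, so that the outcome of the main line is computed by recursion on the derivation.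
  data Ends : S → Set where
    capture : ∀ {s} → S-C s → Ends s
    later   : ∀ {s} → S-NC s → Ends (advance s) → Ends s

  -- The others cannot lower the value of `P₁` by moving, and he plays optimally as long as he can
  -- force a capture.
  win-persists : ∀ {k} s → S-NC s → win k ⊑ value P₁ s → win k ⊑ delay (value P₁ (advance s))
  win-persists s@(_ , P₂) nc wins = ⊑-trans wins (value-other P₁ nc (λ ()) (proj₂ (main s)))
  win-persists s@(_ , P₃) nc wins = ⊑-trans wins (value-other P₁ nc (λ ()) (proj₂ (main s)))
  win-persists s@(x , P₁) nc wins = subst
    (λ (v , _) → win _ ⊑ delay (value P₁ (successor s v)))
    (sym (lead-win x wins)) (⊑-trans wins (⊑-reflexive (value-optimal P₁ nc)))

  -- The exponent `k` bounds the number of moves left and drops by one with each of them.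
  win⇒ends : ∀ k s → win k ⊑ value P₁ s → Ends s
  win⇒ends k s wins with S-C? s
  ... | yes c = capture c
  ... | no nc with win⊑delay (win-persists s nc wins)
  ...   | j , refl , wins′ = later nc (win⇒ends j (advance s) wins′)

  -- Lexicographic: the branch confining `P₂`, then the moves left until `P₁` is on turn. The factor
  -- 3 lets one lost vertex pay for the phase rising from 0 to 2.
  chaseRank : S → ℕ
  chaseRank (x , p) = phase p ℕ.+ branchSize x¹ (step x¹ x²) ℕ.* 3
    where
    x¹ = lookup x P₁
    x² = lookup x P₂
    phase : Player → ℕ
    phase P₁ = 0
    phase P₂ = 2
    phase P₃ = 1

  chaseRank-decreases : ∀ s → value P₁ s ⊑ draw → S-NC s → S-NC (advance s) →
    chaseRank (advance s) ℕ.< chaseRank s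
  chaseRank-decreases s@(x@(x¹ ∷ x² ∷ x³ ∷ []) , P₁) noWin nc nc′
    rewrite lead-chase x noWin =
    ℕ.*-monoˡ-≤ 3 (branchSize-decreases (nc ∘ inj₁) (nc′ ∘ inj₁))
  chaseRank-decreases s@(x¹ ∷ x² ∷ x³ ∷ [] , P₂) _ nc nc′
    rewrite step-constant (nc ∘ inj₁) (nc′ ∘ inj₁) (proj₂ (main s)) = ℕ.≤-refl
  chaseRank-decreases s@(x¹ ∷ x² ∷ x³ ∷ [] , P₃) _ _ _ = ℕ.≤-refl

  chase⇒ends : ∀ r s → chaseRank s ℕ.< r → Ends s
  chase⇒ends (suc r) s bound with S-C? s | S-C? (advance s) | win-or-⊑draw (value P₁ s)
  ... | yes c | _     | _               = capture c
  ... | no nc | yes c | _               = later nc (capture c)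
  -- Tested at every state, since the moves of `P₂` and `P₃` may give `P₁` a forced capture in the
  -- middle of a chase.
  ... | no _  | no _  | inj₁ (k , wins) = win⇒ends k s wins
  ... | no nc | no nc′ | inj₂ noWin     = later nc (chase⇒ends r (advance s)
          (ℕ.≤-trans (chaseRank-decreases s noWin nc nc′) (ℕ.s≤s⁻¹ bound)))

  outcomeOf : Player → ∀ {s} → Ends s → Outcome
  outcomeOf m {s} (capture _) = finalOutcome m s
  outcomeOf m     (later _ e) = delay (outcomeOf m e)

  -- The derivation given by `ends` is opaque; exchanging it for one with a known constructor yields
  -- the recursion equations of `outcome`.
  outcomeOf-irrelevant : ∀ m {s} (e e′ : Ends s) → outcomeOf m e ≡ outcomeOf m e′
  outcomeOf-irrelevant m (capture _)  (capture _)  = refl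
  outcomeOf-irrelevant m (capture c)  (later nc _) = contradiction c nc
  outcomeOf-irrelevant m (later nc _) (capture c)  = contradiction c nc
  outcomeOf-irrelevant m (later _ e)  (later _ e′) = cong delay (outcomeOf-irrelevant m e e′)

  draw⊑outcomeOf-P₁ : ∀ {s} (e : Ends s) → draw ⊑ outcomeOf P₁ e
  draw⊑outcomeOf-P₁ {s} (capture _) with does (S̃¹? s)
  ... | true  = draw⊑win
  ... | false = draw⊑draw
  draw⊑outcomeOf-P₁ (later _ e) = delay-mono (draw⊑outcomeOf-P₁ e)

  -- Induction along the main line: moves of others do not lower the value of `m`, and his own
  -- optimal moves preserve it. When `P₁` merely chases, his value is at most `draw` and his outcome
  -- at least that.
  value⊑outcomeOf : ∀ m {s} (e : Ends s) → value m s ⊑ outcomeOf m e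
  value⊑outcomeOf m (capture c) = ⊑-reflexive (value-captured m c)
  value⊑outcomeOf m {s} (later nc e) with mover s ≟ m
  ... | no other = ⊑-trans
    (value-other m nc other (proj₂ (main s))) (delay-mono (value⊑outcomeOf m e))
  value⊑outcomeOf P₂ {_ , P₂} (later nc e) | yes refl =
    ⊑-trans (⊑-reflexive (value-optimal P₂ nc)) (delay-mono (value⊑outcomeOf P₂ e))
  value⊑outcomeOf P₃ {_ , P₃} (later nc e) | yes refl =
    ⊑-trans (⊑-reflexive (value-optimal P₃ nc)) (delay-mono (value⊑outcomeOf P₃ e))
  value⊑outcomeOf P₁ {s@(x , P₁)} (later nc e) | yes refl with win-or-⊑draw (value P₁ s)
  ... | inj₂ noWin      = ⊑-trans noWin (delay-mono (draw⊑outcomeOf-P₁ e))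
  ... | inj₁ (_ , wins) = ⊑-trans (⊑-reflexive eq) (delay-mono (value⊑outcomeOf P₁ e))
    where
    eq : value P₁ s ≡ delay (value P₁ (advance s))
    eq = trans (value-optimal P₁ nc)
      (cong (λ (v , _) → delay (value P₁ (successor s v))) (sym (lead-win x wins)))

  somebody-wins : ∀ {s} (e : Ends s) →
    (∃[ k ] outcomeOf P₁ e ≡ win k) ⊎ (∃[ k ] outcomeOf P₂ e ≡ win k)
  somebody-wins {x , p} (capture c) with lookup x P₁ ≟ lookup x P₂ | lookup x P₂ ≟ lookup x P₃
  ... | yes _  | _      = inj₁ (0 , refl)
  ... | no _   | yes _  = inj₂ (0 , refl)
  ... | no ¬c₁ | no ¬c₂ = contradiction c Sum.[ ¬c₁ , ¬c₂ ]
  somebody-wins (later _ e) = Sum.map wins-later wins-later (somebody-wins e)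
    where
    wins-later : ∀ {o} → ∃[ k ] o ≡ win k → ∃[ k ] delay o ≡ win k
    wins-later (k , refl) = suc k , refl

  abstract
    ends : ∀ s → Ends s
    ends s = chase⇒ends _ s ℕ.≤-refl

  outcome : Player → S → Outcome
  outcome m s = outcomeOf m (ends s)

  outcome-captured : ∀ m {s} → S-C s → outcome m s ≡ finalOutcome m s
  outcome-captured m {s} c = outcomeOf-irrelevant m (ends s) (capture c)

  outcome-live : ∀ m {s} → S-NC s → outcome m s ≡ delay (outcome m (advance s))
  outcome-live m {s} nc = outcomeOf-irrelevant m (ends s) (later nc (ends (advance s)))

-- Trigger strategies

module Trigger {n : ℕ} (G : Graph n) (isTree : Graph.IsTree G) where

  open Graph G
  open Game G
  open Values G
  open ZeroSum
  open MainPlay G isTree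

  _≟ˢ_ : DecidableEquality State
  s̄     ≟ˢ s̄      = yes refl
  s̄     ≟ˢ inS _  = no λ ()
  inS _ ≟ˢ s̄      = no λ ()
  inS s ≟ˢ inS s′ = map′ (cong inS) (λ { refl → refl }) (Product.≡-dec (Vec.≡-dec _≟_) _≟_ s s′)

  T-captured : ∀ {s} a → S-C s → T (inS s) a ≡ s̄
  T-captured {s} a c with S-C? s | a
  ... | yes _ | _ = refl
  ... | no nc | _ = contradiction c nc

  T-live : ∀ {s} v → S-NC s → T (inS s) (to v) ≡ inS (successor s v)
  T-live {s} v nc with S-C? s
  ... | yes c = contradiction c nc
  ... | no _  = refl

  -- nothing: the main line has been followed so far;
  -- just k:  player k was the first to leave it and is being punished.
  Mode : Set
  Mode = Maybe Player

  policy : Mode → Policy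
  policy nothing  = main
  policy (just k) = optimal k

  mainline : State → State
  mainline s̄       = s̄
  mainline (inS s) = T (inS s) (to (proj₁ (main s)))

  -- A deviation is recognised by the state it produces and is blamed on the player who had the
  -- move, since histories record no actions.
  updateMode : Mode → State → State → Mode
  updateMode (just k) _       _  = just k
  updateMode nothing  s̄       _  = nothing
  updateMode nothing  (inS s) s′ =
    if does (s′ ≟ˢ mainline (inS s)) then nothing else just (mover s)

  modeAfter : State → List State → Mode
  modeAfter s []      = nothing
  modeAfter s (r ∷ h) = updateMode (modeAfter r h) r s

  mode : History → Mode
  mode h = modeAfter (head h) (tail h)

  respond : Policy → ∀ m s → ∃[ a ] A m s a
  respond π m s̄ = λ-null , terminal
  respond π m (inS s) with S-C? s | m ≟ mover s
  ... | yes c | _      = λ-null , captured c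
  ... | no nc | yes eq = to (proj₁ (π s)) , move nc eq (proj₂ (π s))
  ... | no nc | no neq = to (lookup (proj₁ s) m) , stay nc neq

  T-respond : ∀ π s →
    T (inS s) (proj₁ (respond π (mover s) (inS s))) ≡ T (inS s) (to (proj₁ (π s)))
  T-respond π s with S-C? s | mover s ≟ mover s
  ... | yes _ | _      = refl
  ... | no _  | yes _  = refl
  ... | no _  | no neq = contradiction refl neq

  equilibrium : Profile
  equilibrium m h = respond (policy (mode h)) m (head h)

  mainline-mode : ∀ s → updateMode nothing s (mainline s) ≡ nothing
  mainline-mode s̄       = refl
  mainline-mode (inS s) rewrite dec-true (mainline (inS s) ≟ˢ mainline (inS s)) refl = refl

  equilibrium-mainline : ∀ s h → modeAfter s h ≡ nothing →
    T s (chosenAction equilibrium (s ∷ h)) ≡ mainline s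
  equilibrium-mainline s̄       h _  = refl
  equilibrium-mainline (inS s) h eq = trans
    (cong (λ md → T (inS s) (proj₁ (respond (policy md) (mover s) (inS s)))) eq)
    (T-respond main s)

  equilibrium-mode : ∀ s₀ t → mode (playHistory s₀ equilibrium t) ≡ nothing
  equilibrium-mode s₀ zero = refl
  equilibrium-mode s₀ (suc t) = trans
    (cong₂ (λ md → updateMode md (head h)) (equilibrium-mode s₀ t)
      (equilibrium-mainline (head h) (tail h) (equilibrium-mode s₀ t)))
    (mainline-mode (head h))
    where
    h = playHistory s₀ equilibrium t

  equilibrium-play : ∀ s₀ t → play s₀ equilibrium (suc t) ≡ mainline (play s₀ equilibrium t)
  equilibrium-play s₀ t = equilibrium-mainline (head h) (tail h) (equilibrium-mode s₀ t)
    where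
    h = playHistory s₀ equilibrium t

  -- Serves as a potential for the payoff still to come. In punishment mode it is the value for `m`
  -- whoever is punished; `OnlyDeviator` ensures that this is `m`.
  worth : Player → Mode → State → Outcome
  worth m _        s̄       = draw
  worth m nothing  (inS s) = outcome m s
  worth m (just _) (inS s) = value m s

  worth-captured : ∀ m md {s} → S-C s → worth m md (inS s) ≡ finalOutcome m s
  worth-captured m nothing  c = outcome-captured m c
  worth-captured m (just _) c = value-captured m c

  -- The worth w of a state consists of the payoff collected there and the delayed
  -- worth w′ of the next state, up to the relation _∼_.
  data Unfolds (_∼_ : Rel Outcome 0ℓ) (m : Player) : State → Rel Outcome 0ℓ where
    over   : Unfolds _∼_ m s̄ draw draw
    caught : ∀ {s w} → w ≡ finalOutcome m s → Unfolds _∼_ m (inS s) w draw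
    goesOn : ∀ {s w w′} → finalOutcome m s ≡ draw → delay w′ ∼ w → Unfolds _∼_ m (inS s) w w′

  mainline-unfolds : ∀ m s → Unfolds _≡_ m s (worth m nothing s) (worth m nothing (mainline s))
  mainline-unfolds m s̄ = over
  mainline-unfolds m (inS s) with S-C? s
  ... | yes c = caught (outcome-captured m c)
  ... | no nc = goesOn (finalOutcome-live m nc) (sym (outcome-live m nc))

  updateMode-cases : ∀ s s′ →
    (s′ ≡ mainline (inS s) × updateMode nothing (inS s) s′ ≡ nothing) ⊎
    (s′ ≢ mainline (inS s) × updateMode nothing (inS s) s′ ≡ just (mover s))
  updateMode-cases s s′ with s′ ≟ˢ mainline (inS s)
  ... | yes same = inj₁ (same , refl)
  ... | no left  = inj₂ (left , refl)

  OnlyDeviator : Player → Mode → Set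
  OnlyDeviator m nothing  = ⊤
  OnlyDeviator m (just k) = k ≡ m

  -- A step that is free if m moves and prescribed by the mode if another player does.
  Admissible : Player → Mode → State → State → Set
  Admissible m md s̄       s′ = s′ ≡ s̄
  Admissible m md (inS s) s′ =
    (S-C s → s′ ≡ s̄) ×
    (S-NC s → ∃[ v ] Legal s v × s′ ≡ inS (successor s v)) ×
    (mover s ≢ m → s′ ≡ T (inS s) (to (proj₁ (policy md s))))

  -- Had another player been on turn, the step would have been the prescribed one and nobody would
  -- be blamed.
  admissible-onlyDeviator : ∀ {m} md s {s′} → OnlyDeviator m md → Admissible m md s s′ →
    OnlyDeviator m (updateMode md s s′)
  admissible-onlyDeviator     (just _) _       ok _ = ok
  admissible-onlyDeviator     nothing  s̄       _  _ = tt
  admissible-onlyDeviator {m} nothing  (inS s) {s′} _ (_ , _ , prescribed)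
    with updateMode-cases s s′
  ... | inj₁ (_ , eq)    rewrite eq = tt
  ... | inj₂ (left , eq) rewrite eq = decidable-stable (mover s ≟ m) (left ∘ prescribed)

  -- No step raises the worth of a sole deviator: this is the local inequality behind the
  -- equilibrium.
  admissible-live : ∀ {m} md {s v} → OnlyDeviator m md → S-NC s → Legal s v →
    (mover s ≢ m → inS (successor s v) ≡ T (inS s) (to (proj₁ (policy md s)))) →
    let s′ = inS (successor s v) in
    delay (worth m (updateMode md (inS s) s′) s′) ⊑ worth m md (inS s)
  admissible-live {m} nothing {s} {v} _ nc legal prescribed
    with updateMode-cases s (inS (successor s v))
  ... | inj₁ (same , eq) rewrite eq = ⊑-reflexive (trans
          (cong (λ st → delay (worth m nothing st)) (trans same (T-live _ nc)))
          (sym (outcome-live m nc)))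
  -- On leaving the main line `m` can secure at most his zero-sum value, and staying on it gives at
  -- least that.
  ... | inj₂ (left , eq) rewrite eq = ⊑-trans
          (value-own m nc (decidable-stable (mover s ≟ m) (left ∘ prescribed)) legal)
          (value⊑outcomeOf m (ends s))
  admissible-live {m} (just _) {s} {v} refl nc legal prescribed =
    Sum.[ (λ own → value-own m {s} nc own legal) , punished ]′
    (toSum (mover s ≟ m))
    where
    punished : mover s ≢ m → delay (value m (successor s v)) ⊑ value m s
    -- The punishers follow `optimal m`, whose move attains the value exactly.
    punished other = ⊑-reflexive (trans
      (cong (λ st → delay (worth m (just m) st)) (trans (prescribed other) (T-live _ nc)))
      (sym (value-optimal m nc)))

  admissible-unfolds : ∀ {m} md s {s′} → OnlyDeviator m md → Admissible m md s s′ →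
    Unfolds _⊑_ m s (worth m md s) (worth m (updateMode md s s′) s′)
  admissible-unfolds md s̄ ok refl = over
  admissible-unfolds {m} md (inS s) {s′} ok (caught-next , live-next , prescribed) =
    unfolds (S-C? s)
    where
    unfolds : Dec (S-C s) →
      Unfolds _⊑_ m (inS s) (worth m md (inS s)) (worth m (updateMode md (inS s) s′) s′)
    unfolds (yes c) rewrite caught-next c = caught (worth-captured m md c)
    unfolds (no nc) with live-next nc
    ... | v , legal , refl =
          goesOn (finalOutcome-live m nc) (admissible-live md ok nc legal prescribed)

  -- Unilateral deviations

  module Deviation (m : Player) (τ : Strategy m) where

    deviated : Profile
    deviated = equilibrium [ m ↦ τ ]

    deviated-other : ∀ {k} → k ≢ m → ∀ h → deviated k h ≡ equilibrium k h
    deviated-other {k} k≢m h with k ≟ m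
    ... | yes k≡m = contradiction k≡m k≢m
    ... | no _    = refl

    nextState : History → State
    nextState h = T (head h) (chosenAction deviated h)

    nextState-other : ∀ {s} h → mover s ≢ m →
      nextState (inS s ∷ h) ≡ T (inS s) (to (proj₁ (policy (modeAfter (inS s) h) s)))
    nextState-other {s} h other = trans
      (cong (T (inS s) ∘ proj₁) (deviated-other other (inS s ∷ h))) (T-respond _ s)

    nextState-live : ∀ {s} h → S-NC s →
      ∃[ v ] Legal s v × nextState (inS s ∷ h) ≡ inS (successor s v)
    nextState-live {s} h nc with deviated (mover s) (inS s ∷ h)
    ... | _ , move _ _ legal = _ , legal , T-live _ nc
    ... | _ , stay _ neq     = contradiction refl neq
    ... | _ , captured c     = contradiction c nc


    nextState-admissible : ∀ s h → Admissible m (modeAfter s h) s (nextState (s ∷ h))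
    nextState-admissible s̄       h = refl
    nextState-admissible (inS s) h = T-captured _ , nextState-live h , nextState-other h

    module _ (s₀ : S) where

      deviatedMode : ℕ → Mode
      deviatedMode t = mode (playHistory s₀ deviated t)

      deviated-onlyDeviator : ∀ t → OnlyDeviator m (deviatedMode t)
      deviated-onlyDeviator zero    = tt
      deviated-onlyDeviator (suc t) = admissible-onlyDeviator _ (head h)
        (deviated-onlyDeviator t) (nextState-admissible (head h) (tail h))
        where
        h = playHistory s₀ deviated t

      deviatedWorth : ℕ → Outcome
      deviatedWorth t = worth m (deviatedMode t) (play s₀ deviated t)

      deviatedWorth-unfolds : ∀ t →
        Unfolds _⊑_ m (play s₀ deviated t) (deviatedWorth t) (deviatedWorth (suc t))
      deviatedWorth-unfolds t = admissible-unfolds _ (head h)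
        (deviated-onlyDeviator t) (nextState-admissible (head h) (tail h))
        where
        h = playHistory s₀ deviated t

  equilibriumWorth : Player → S → ℕ → Outcome
  equilibriumWorth m s₀ t = worth m nothing (play s₀ equilibrium t)

  equilibriumWorth-unfolds : ∀ m s₀ t → Unfolds _≡_ m (play s₀ equilibrium t)
    (equilibriumWorth m s₀ t) (equilibriumWorth m s₀ (suc t))
  equilibriumWorth-unfolds m s₀ t = subst
    (λ st → Unfolds _≡_ m (play s₀ equilibrium t) (equilibriumWorth m s₀ t) (worth m nothing st))
    (sym (equilibrium-play s₀ t)) (mainline-unfolds m (play s₀ equilibrium t))

-- Discounted payoffs

partialSum-step : ∀ {c ℓ} (R : CommutativeSemiring c ℓ) (let open CommutativeSemiring R) →
  ∀ s p f g h → (s + p * f) + (g * p) * h ≈ s + p * (f + g * h)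
partialSum-step R = solve 5 (λ s p f g h →
  (s :+ p :* f) :+ (g :* p) :* h := s :+ p :* (f :+ g :* h)) ≈-refl
  where
  open CommutativeSemiring R using () renaming (refl to ≈-refl)
  open Solver R using (solve; _:=_; _:+_; _:*_)

module DiscountedOutcomes {c ℓ₁ ℓ₂} (ℝ : RealField c ℓ₁ ℓ₂)
  (γ : RealField.Carrier ℝ)
  (0<γ : RealField._<_ ℝ (RealField.0# ℝ) γ)
  (γ<1 : RealField._<_ ℝ γ (RealField.1# ℝ)) where

  open RealField ℝ
  open CommutativeRing commutativeRing
    hiding (Carrier; _≈_; _+_; _*_; -_; 0#; 1#)
    renaming (refl to ≈-refl; sym to ≈-sym; trans to ≈-trans)
  open RingProperties ring using (-‿distribʳ-*)
  open RealProperties ℝ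
  open Discounting ℝ γ 0<γ γ<1

  payoff : Outcome → Carrier
  payoff (win k)  = γ ^ k
  payoff (lose k) = - (γ ^ k)
  payoff draw     = 0#

  payoff-delay : ∀ o → γ * payoff o ≈ payoff (delay o)
  payoff-delay (win k)  = ≈-refl
  payoff-delay (lose k) = ≈-sym (-‿distribʳ-* γ (γ ^ k))
  payoff-delay draw     = zeroʳ γ

  γ^-antitone : ∀ {j k} → j ℕ.≤ k → γ ^ k ≤ γ ^ j
  γ^-antitone {k = zero}  ℕ.z≤n = ≤-reflexive ≈-refl
  γ^-antitone {k = suc k} ℕ.z≤n = ≤-trans (*-monoˡ-≤ 0<γ (γ^-antitone {k = k} ℕ.z≤n))
                                          (≤-resp (≈-sym (*-identityʳ γ)) ≈-refl (<⇒≤ γ<1))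
  γ^-antitone (ℕ.s≤s j≤k) = *-monoˡ-≤ 0<γ (γ^-antitone j≤k)

  neg-antitone : ∀ {x y} → x ≤ y → - y ≤ - x
  neg-antitone {x} {y} x≤y = ≤-resp
    (≈-trans (≈-sym (+-assoc x (- x) (- y))) (≈-trans (+-congʳ (-‿inverseʳ x)) (+-identityˡ _)))
    (≈-trans (+-congˡ (+-comm (- x) (- y)))
      (≈-trans (≈-sym (+-assoc y (- y) (- x))) (≈-trans (+-congʳ (-‿inverseʳ y)) (+-identityˡ _))))
    (+-monoˡ-≤ (- x + - y) x≤y)

  -γ^<0 : ∀ k → - (γ ^ k) < 0#
  -γ^<0 k = -x<0 (0<γ^ k)

  payoff-mono : ∀ {o o′} → o ⊑ o′ → payoff o ≤ payoff o′
  payoff-mono (lose⊑lose p)      = neg-antitone (γ^-antitone p)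
  payoff-mono (lose⊑draw {j})    = <⇒≤ (-γ^<0 j)
  payoff-mono (lose⊑win {j} {k}) = <⇒≤ (<-trans (-γ^<0 j) (0<γ^ k))
  payoff-mono draw⊑draw          = ≤-reflexive ≈-refl
  payoff-mono (draw⊑win {k})     = <⇒≤ (0<γ^ k)
  payoff-mono (win⊑win p)        = γ^-antitone p

  γ^*payoff≤γ^ : ∀ t o → (γ ^ t) * payoff o ≤ γ ^ t
  γ^*payoff≤γ^ t o = ≤-resp ≈-refl (*-identityʳ _) (*-monoˡ-≤ (0<γ^ t) (payoff-mono (⊑win-zero o)))

  0≤γ^*payoff+γ^ : ∀ t o → 0# ≤ (γ ^ t) * payoff o + γ ^ t
  0≤γ^*payoff+γ^ t o = ≤-resp (zeroʳ _) (≈-trans (distribˡ _ _ _) (+-congˡ (*-identityʳ _)))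
    (*-monoˡ-≤ (0<γ^ t)
      (≤-resp (-‿inverseˡ 1#) ≈-refl (+-monoˡ-≤ 1# (payoff-mono (lose-zero⊑ o)))))

  x+[y-x]≈y : ∀ x y → x + (y - x) ≈ y
  x+[y-x]≈y x y = ≈-trans (+-congˡ (+-comm y (- x)))
    (≈-trans (≈-sym (+-assoc x (- x) y)) (≈-trans (+-congʳ (-‿inverseʳ x)) (+-identityˡ y)))

  module _ {S : ℕ → Carrier} {l : Carrier} (S⟶l : S ⟶ l) {x : Carrier} where

    limit≤ : (∀ t → S t ≤ x + γ ^ t) → l ≤ x
    limit≤ bound x<l =
      -- Half of the gap absorbs the distance of `S t` from the limit, the other half the error
      -- `γ ^ t` for `t` at least `n`.
      let n , 2γⁿ<gap = γ^-small (0<y-x x<l)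
          N , close   = S⟶l (0<γ^ n)
          t           = n ℕ.⊔ N
      in  <-irrefl ≈-refl (<-trans (proj₂ (close {t} (ℕ.m≤n⊔m n N))) (≤-<-trans
            (+-monoˡ-≤ (γ ^ n) (≤-trans (bound t) (+-monoʳ-≤ x (γ^-antitone (ℕ.m≤m⊔n n N)))))
            (<-resp (≈-sym (+-assoc x (γ ^ n) (γ ^ n))) (x+[y-x]≈y x l) (+-monoʳ-< x 2γⁿ<gap))))

    ≤limit : (∀ t → x ≤ S t + γ ^ t) → x ≤ l
    ≤limit bound l<x =
      let n , 2γⁿ<gap = γ^-small (0<y-x l<x)
          N , close   = S⟶l (0<γ^ n)
          t           = n ℕ.⊔ N
      in  bound t (<-trans (+-monoˡ-< (γ ^ t) (proj₁ (close {t} (ℕ.m≤n⊔m n N)))) (≤-<-trans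
            (+-monoʳ-≤ (l + γ ^ n) (γ^-antitone (ℕ.m≤m⊔n n N)))
            (<-resp (≈-sym (+-assoc l (γ ^ n) (γ ^ n))) (x+[y-x]≈y l x) (+-monoʳ-< l 2γⁿ<gap))))

  module _ (f : ℕ → Carrier) (w : ℕ → Outcome) where

    private
      Σf : ℕ → Carrier
      Σf = partialSum (λ t → γ ^ t * f t)

    -- Payoff collected before time `t` plus the discounted worth of the rest. A one-step inequality
    -- makes it monotone in `t`, and it stays within `γ ^ t` of the partial sum, so its initial
    -- value bounds the series.
    potential : ℕ → Carrier
    potential t = Σf t + γ ^ t * payoff (w t)

    potential-zero : potential 0 ≈ payoff (w 0)
    potential-zero = ≈-trans (+-identityˡ _) (*-identityˡ _)

    potential-suc : ∀ t →
      potential (suc t) ≈ Σf t + γ ^ t * (f t + γ * payoff (w (suc t)))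
    potential-suc t = partialSum-step commutativeSemiring
      (Σf t) (γ ^ t) (f t) γ (payoff (w (suc t)))

    partialSum≤potential+γ^ : ∀ t → Σf t ≤ potential t + γ ^ t
    partialSum≤potential+γ^ t = ≤-resp (+-identityʳ (Σf t)) (≈-sym (+-assoc (Σf t) _ _))
      (+-monoʳ-≤ (Σf t) (0≤γ^*payoff+γ^ t (w t)))

    potential≤partialSum+γ^ : ∀ t → potential t ≤ Σf t + γ ^ t
    potential≤partialSum+γ^ t = +-monoʳ-≤ (Σf t) (γ^*payoff≤γ^ t (w t))

    module _ (step : ∀ t → f t + γ * payoff (w (suc t)) ≤ payoff (w t)) where

      potential≤ : ∀ t → potential t ≤ payoff (w 0)
      potential≤ zero    = ≤-reflexive potential-zero
      potential≤ (suc t) = ≤-trans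
        (≤-resp (≈-sym (potential-suc t)) ≈-refl (+-monoʳ-≤ (Σf t) (*-monoˡ-≤ (0<γ^ t) (step t))))
        (potential≤ t)

      discountedSum≤payoff : ∀ f-bounded → discountedSum f f-bounded ≤ payoff (w 0)
      discountedSum≤payoff f-bounded =
        limit≤ (proj₂ (complete Σf (discounted-cauchy f f-bounded))) λ t →
          ≤-trans (partialSum≤potential+γ^ t) (+-monoˡ-≤ (γ ^ t) (potential≤ t))

    module _ (step : ∀ t → payoff (w t) ≤ f t + γ * payoff (w (suc t))) where

      ≤potential : ∀ t → payoff (w 0) ≤ potential t
      ≤potential zero    = ≤-reflexive (≈-sym potential-zero)
      ≤potential (suc t) = ≤-trans (≤potential t)
        (≤-resp ≈-refl (≈-sym (potential-suc t)) (+-monoʳ-≤ (Σf t) (*-monoˡ-≤ (0<γ^ t) (step t))))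

      payoff≤discountedSum : ∀ f-bounded → payoff (w 0) ≤ discountedSum f f-bounded
      payoff≤discountedSum f-bounded =
        ≤limit (proj₂ (complete Σf (discounted-cauchy f f-bounded))) λ t →
          ≤-trans (≤potential t) (potential≤partialSum+γ^ t)

-- The equilibrium inequalities

module Nash {c ℓ₁ ℓ₂} (ℝ : RealField c ℓ₁ ℓ₂)
  {n : ℕ} (G : Graph n) (isTree : Graph.IsTree G)
  (γ : RealField.Carrier ℝ)
  (0<γ : RealField._<_ ℝ (RealField.0# ℝ) γ)
  (γ<1 : RealField._<_ ℝ γ (RealField.1# ℝ)) where

  open RealField ℝ

  open Game G
  open Payoff ℝ γ 0<γ γ<1
  open RealProperties ℝ
  open CommutativeRing commutativeRing using (+-identityˡ; +-identityʳ; +-congˡ; zeroʳ)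
    renaming (sym to ≈-sym; trans to ≈-trans)
  open Discounting ℝ γ 0<γ γ<1 using (0<γ^)
  open DiscountedOutcomes ℝ γ 0<γ γ<1
  open Values G using (finalOutcome)
  open MainPlay G isTree
  open Trigger G isTree

  payoff-final : ∀ m s → payoff (finalOutcome m s) ≡ q m (inS s)
  payoff-final P₁ s with does (S̃¹? s)
  ... | true  = refl
  ... | false = refl
  payoff-final P₂ s with does (S̃¹? s) | does (S̃²? s)
  ... | true  | _     = refl
  ... | false | true  = refl
  ... | false | false = refl
  payoff-final P₃ s with does (S̃¹? s) | does (S̃²? s)
  ... | true  | _     = refl
  ... | false | true  = refl
  ... | false | false = refl

  q-final : ∀ {m s} {o : Outcome} → finalOutcome m s ≡ o → q m (inS s) ≡ payoff o
  q-final {m} {s} eq = trans (sym (payoff-final m s)) (cong payoff eq)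

  q-then-draw : ∀ m s → q m (inS s) + γ * payoff draw ≈ q m (inS s)
  q-then-draw m s = ≈-trans (+-congˡ (zeroʳ γ)) (+-identityʳ _)

  nothing-then : ∀ {m s} w → finalOutcome m s ≡ draw →
    q m (inS s) + γ * payoff w ≈ payoff (delay w)
  nothing-then {m} {s} w live = subst (λ x → x + γ * payoff w ≈ payoff (delay w))
    (sym (q-final {m} {s} live)) (≈-trans (+-identityˡ _) (payoff-delay w))

  unfolds-≈ : ∀ {m s w w′} → Unfolds _≡_ m s w w′ → q m s + γ * payoff w′ ≈ payoff w
  unfolds-≈ over = ≈-trans (+-identityˡ _) (zeroʳ γ)
  unfolds-≈ {m} (caught {s} refl) =
    subst (q m (inS s) + γ * payoff draw ≈_) (sym (payoff-final m s)) (q-then-draw m s)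
  unfolds-≈ {m} (goesOn {s} {w′ = w′} live refl) = nothing-then {m} {s} w′ live

  unfolds-≤ : ∀ {m s w w′} → Unfolds _⊑_ m s w w′ → q m s + γ * payoff w′ ≤ payoff w
  unfolds-≤ {m} over       = ≤-reflexive (unfolds-≈ {m} over)
  unfolds-≤ {m} (caught e) = ≤-reflexive (unfolds-≈ {m} (caught e))
  unfolds-≤ {m} (goesOn {s} {w′ = w′} live w′⊑w) =
    ≤-trans (≤-reflexive (nothing-then {m} {s} w′ live)) (payoff-mono w′⊑w)

  -- Every play starts in mode `nothing`, so its worth at time 0 is `outcome m s₀`; the payoff of
  -- this outcome separates the equilibrium payoff from that of any deviation.
  Q-equilibrium : ∀ m s₀ → payoff (outcome m s₀) ≤ Q m s₀ equilibrium
  Q-equilibrium m s₀ = payoff≤discountedSum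
    (λ t → q m (play s₀ equilibrium t)) (equilibriumWorth m s₀)
    (λ t → ≤-reflexive (≈-sym (unfolds-≈ (equilibriumWorth-unfolds m s₀ t)))) _

  Q-deviated : ∀ m τ s₀ → Q m s₀ (equilibrium [ m ↦ τ ]) ≤ payoff (outcome m s₀)
  Q-deviated m τ s₀ = discountedSum≤payoff
    (λ t → q m (play s₀ deviated t)) (deviatedWorth s₀)
    (λ t → unfolds-≤ (deviatedWorth-unfolds s₀ t)) _
    where open Deviation m τ

  isNash : ∀ s₀ → IsNashEquilibrium s₀ equilibrium
  isNash s₀ m τ = ≤-trans (Q-deviated m τ s₀) (Q-equilibrium m s₀)

  Q-winner : ∀ m s₀ {k} → outcome m s₀ ≡ win k → 0# < Q m s₀ equilibrium
  Q-winner m s₀ {k} eq = <-≤-trans (0<γ^ k)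
    (subst (λ o → payoff o ≤ Q m s₀ equilibrium) eq (Q-equilibrium m s₀))

theorem5p12 : ∀ {c ℓ₁ ℓ₂} (ℝ : RealField c ℓ₁ ℓ₂) (let open RealField ℝ)
    {n : ℕ} (G : Graph n) → Graph.IsTree G →
    (γ : Carrier) (0<γ : 0# < γ) (γ<1 : γ < 1#) →
    (let open Game G) (let open Payoff ℝ γ 0<γ γ<1) →
    (s₀ : S) →
    ∃[ σ̂ ] IsNashEquilibrium s₀ σ̂ × ∃[ k ] K₃ s₀ σ̂ k × k >ℕ 0
theorem5p12 ℝ G isTree γ 0<γ γ<1 s₀ =
  equilibrium , isNash s₀ , winner-captures (somebody-wins (ends s₀))
  where
  open Game G
  open Payoff ℝ γ 0<γ γ<1
  open MainPlay G isTree
  open Trigger G isTree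
  open Nash ℝ G isTree γ 0<γ γ<1

  winner-captures : (∃[ k ] outcome P₁ s₀ ≡ win k) ⊎ (∃[ k ] outcome P₂ s₀ ≡ win k) →
    ∃[ k ] K₃ s₀ equilibrium k × k >ℕ 0
  winner-captures (inj₁ (_ , eq)) = 1 , K≡1 (Q-winner P₁ s₀ eq) , ℕ.s≤s ℕ.z≤n
  winner-captures (inj₂ (_ , eq)) = 2 , K≡2 (Q-winner P₂ s₀ eq) , ℕ.s≤s ℕ.z≤n
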